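{- Let $\varepsilon\in(0,1)$ and $n\in\mathbb{N}$ with $\varepsilon n\ge4$. For every local property $\mathcal{P}$ of sequences $f:[n]\to\mathbb{R}$, the pair tester with parameters $\mathcal{P},\varepsilon$ is a nonadaptive $\varepsilon$-tester for $\mathcal{P}$ with one-sided error in the offline testing model (without erasures or corruptions), with error probability at most $1/7$. That is, it always accepts every $f\in\mathcal{P}$, and it rejects every $f$ that is $\varepsilon$-far from $\mathcal{P}$ with probability at least $6/7$.
   Context: $\log$ is base 2; $[n]=\{1,\dots,n\}$; $[a:b]=\{i\in\mathbb{Z}:a\le i\le b\}$. A property $\mathcal{P}$ of sequences $f:[n]\to\mathbb{R}$ is local if there is a family $\mathcal{F}\subseteq\mathbb{R}^2$ of forbidden pairs such that $f\in\mathcal{P}$ iff $(f(i),f(i+1))\notin\mathcal{F}$ for all $i\in[n-1]$. For $S\subseteq[n]$, $f$ is unrepairable on $S$ (with respect to $\mathcal{P}$) if no $f':[n]\to\mathbb{R}$ that agrees with $f$ on $S$ satisfies $\mathcal{P}$. $f$ is $\varepsilon$-far from $\mathcal{P}$ if at least an $\varepsilon$ fraction of its values must be changed to obtain a sequence in $\mathcal{P}$. Let $D_d(n)=\{(x,y)\in[n]^2: y-x\equiv d\pmod n\}$. Pair tester: set $\ell=\lfloor\log(\varepsilon n/4)\rfloor$. Repeat $\frac{200\log(\varepsilon n)}{\varepsilon}$ times (rounded up to an integer), with independent randomness: sample $i\in[0:\ell]$ uniformly at random, sample $(x,y)\in D_{2^i}(n)$ uniformly at random, query $f(x)$ and $f(y)$,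 and reject if $f$ is unrepairable on $\{x,y\}$. If no iteration rejects, accept. -}

module Defs where

import Algebra.Definitions.RawSemiring
import Algebra.Properties.Semiring.Exp
open import Algebra.Bundles using (module CommutativeRing)
open import Axiom.ExcludedMiddle using (ExcludedMiddle)
open import Data.Bool.Base using (Bool; true; false; if_then_else_)
open import Data.Empty using (⊥-elim)
open import Data.Fin.Base using (Fin; toℕ)
open import Data.Integer.Base as ℤ using (+_)
import Data.Integer.Properties as ℤ
open import Data.Integer.Divisibility.Signed using (_∣_; _∣?_)
open import Data.List.Base as List
  using (List; []; _∷_; map; concatMap; filter; length; allFin; upTo; cartesianProduct)
open import Data.List.Membership.Propositional using (_∈_)
open import Data.Nat.Base as ℕ using (ℕ; zero; suc; z≤n; s≤s)
import Data.Nat.Properties as ℕ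
open import Data.Product.Base using (Σ-syntax; ∃; ∃-syntax; _×_; _,_; proj₁; proj₂)
open import Data.Rational.Base as ℚ using (ℚ; 0ℚ; 1ℚ; ↥_; ↧_; ↧ₙ_; *<*; *≤*)
import Data.Rational.Properties as ℚ
open import Data.Rational.Unnormalised.Base using (mkℚᵘ; *≡*; *≤*)
import Data.Rational.Unnormalised.Properties as ℚᵘ
open import Data.Vec.Base as Vec using (Vec; []; _∷_)
open import Function.Base using (_∘_)
open import Function.Bundles using (_⇔_)
open import Level using (Level; Setω; 0ℓ; _⊔_) renaming (suc to lsuc)
open import Relation.Binary.Core using (Rel)
open import Relation.Binary.Definitions using (_Respects₂_)
open import Relation.Binary.PropositionalEquality
open import Relation.Nullary using (¬_; yes; no; does; ¬?)
open import Relation.Unary using (Pred; _∪_; ｛_｝)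

open Algebra.Definitions.RawSemiring ℚ.+-*-rawSemiring public using (_^_)

module Exp = Algebra.Properties.Semiring.Exp
  (CommutativeRing.semiring ℚ.+-*-commutativeRing)

ℕ⇒ℚ : ℕ → ℚ
ℕ⇒ℚ k = + k ℚ./ 1

-- The development is classical, so a real number x is its lower Dedekind
-- cut { q ∈ ℚ ∣ q < x }; no upper cut or locatedness is needed.  Distinct
-- cuts (as predicates) may describe the same real, hence the setoid
-- equality _≈_.

record ℝ : Set₁ where
  field
    lower     : ℚ → Set
    inhabited : ∃[ q ] lower q
    bounded   : ∃[ b ] (∀ {q} → lower q → q ℚ.< b)
    closed    : ∀ {p q} → p ℚ.< q → lower q → lower p
    rounded   : ∀ {q} → lower q → ∃[ r ] q ℚ.< r × lower r

open ℝ public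

infix 4 _≤_ _<_ _≈_

_≤_ : ℝ → ℝ → Set
x ≤ y = ∀ q → lower x q → lower y q

_<_ : ℝ → ℝ → Set
x < y = ∃[ q ] ¬ lower x q × lower y q

_≈_ : ℝ → ℝ → Set
x ≈ y = x ≤ y × y ≤ x

<-≤-trans : ∀ {x y z} → x < y → y ≤ z → x < z
<-≤-trans (q , q≮x , q<y) y≤z = q , q≮x , y≤z q q<y

p<p+1 : ∀ p → p ℚ.< p ℚ.+ 1ℚ
p<p+1 p = subst (ℚ._< p ℚ.+ 1ℚ) (ℚ.+-identityʳ p)
            (ℚ.+-monoʳ-< p (ℚ.positive⁻¹ 1ℚ))

p-1<p : ∀ p → p ℚ.- 1ℚ ℚ.< p
p-1<p p = subst (p ℚ.- 1ℚ ℚ.<_) (ℚ.+-identityʳ p)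
            (ℚ.+-monoʳ-< p (ℚ.negative⁻¹ (ℚ.- 1ℚ)))

*1/-cancel : ∀ p q .{{_ : ℚ.NonZero q}} → (p ℚ.* ℚ.1/ q) ℚ.* q ≡ p
*1/-cancel p q = trans (ℚ.*-assoc p (ℚ.1/ q) q)
  (trans (cong (p ℚ.*_) (ℚ.*-inverseˡ q)) (ℚ.*-identityʳ p))

fromℚ : ℚ → ℝ
fromℚ p = record
  { lower     = ℚ._< p
  ; inhabited = p ℚ.- 1ℚ , p-1<p p
  ; bounded   = p , λ q<p → q<p
  ; closed    = ℚ.<-trans
  ; rounded   = ℚ.<-dense
  }

fromℕ : ℕ → ℝ
fromℕ k = fromℚ (ℕ⇒ℚ k)

-- The product of a natural number and a real.  The strict inequality makes
-- this a cut also for k = 0.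

infixl 7 _·_

_·_ : ℕ → ℝ → ℝ
k · x = record
  { lower     = λ r → ∃[ s ] lower x s × r ℚ.< ℕ⇒ℚ k ℚ.* s
  ; inhabited = let s , s<x = inhabited x in
      ℕ⇒ℚ k ℚ.* s ℚ.- 1ℚ , s , s<x , p-1<p (ℕ⇒ℚ k ℚ.* s)
  ; bounded   = let b , x≤b = bounded x in
      ℕ⇒ℚ k ℚ.* b , λ (s , s<x , r<ks) →
        ℚ.<-≤-trans r<ks (ℚ.*-monoˡ-≤-nonNeg (ℕ⇒ℚ k) {{ℚ.normalize-nonNeg k 1}}
          (ℚ.<⇒≤ (x≤b s<x)))
  ; closed    = λ p<q (s , s<x , q<ks) → s , s<x , ℚ.<-trans p<q q<ks
  ; rounded   = λ (s , s<x , q<ks) →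
      let r , q<r , r<ks = ℚ.<-dense q<ks in r , q<r , s , s<x , r<ks
  }

<-lower : ∀ x {p q} → lower x q → p ℚ.≤ q → lower x p
<-lower x {p} {q} q<x p≤q =
  let r , q<r , r<x = rounded x q<x in closed x (ℚ.≤-<-trans p≤q q<r) r<x

positive-lower : ∀ {y} → fromℕ 0 < y → ∃[ c ] ℚ.Positive c × lower y c
positive-lower {y} (q , q≮0 , q<y) =
  let c , q<c , c<y = rounded y q<y in
  c , ℚ.positive (ℚ.≤-<-trans (ℚ.≮⇒≥ q≮0) q<c) , c<y

lower≤upper : ∀ y {c b} → lower y c → ¬ lower y b → c ℚ.≤ b
lower≤upper y c<y b≮y = ℚ.≮⇒≥ λ b<c → b≮y (closed y b<c c<y)

upper-positive : ∀ {y} → fromℕ 0 < y → ∀ {b} → ¬ lower y b → ℚ.Positive b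
upper-positive {y} 0<y b≮y =
  let c , c>0 , c<y = positive-lower {y} 0<y in
  ℚ.positive (ℚ.<-≤-trans (ℚ.positive⁻¹ c {{c>0}}) (lower≤upper y c<y b≮y))

-- The quotient of x ≥ 0 by y > 0: the supremum of a / b over rationals
-- a < x and b ≥ y.

quotient : (x y : ℝ) → fromℕ 0 < y → ℝ
quotient x y 0<y = record
  { lower     = λ r → ∃[ a ] ∃[ b ] lower x a × ¬ lower y b × r ℚ.* b ℚ.< a
  ; inhabited = inh
  ; bounded   = bnd
  ; closed    = λ { {p} {q} p<q (a , b , a<x , b≮y , qb<a) →
      a , b , a<x , b≮y ,
      ℚ.<-trans (ℚ.*-monoˡ-<-pos b {{upper-positive {y} 0<y b≮y}} p<q) qb<a }
  ; rounded   = rnd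
  }
  where
  Lower : ℚ → Set
  Lower r = ∃[ a ] ∃[ b ] lower x a × ¬ lower y b × r ℚ.* b ℚ.< a

  over : ∀ (p b : ℚ) → ¬ lower y b → ∃[ r ] r ℚ.* b ≡ p
  over p b b≮y = p ℚ.* ℚ.1/ b , *1/-cancel p b
    where
    instance
      b≢0 : ℚ.NonZero b
      b≢0 = ℚ.pos⇒nonZero b {{upper-positive {y} 0<y b≮y}}

  inh : ∃ Lower
  inh =
    let a , a<x = inhabited x
        b , y≤b = bounded y
        b≮y     = λ b<y → ℚ.<-irrefl refl (y≤b b<y)
        r , eq  = over (a ℚ.- 1ℚ) b b≮y
    in r , a , b , a<x , b≮y , subst (ℚ._< a) (sym eq) (p-1<p a)

  rnd : ∀ {q} → Lower q → ∃[ r ] q ℚ.< r × Lower r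
  rnd {q} (a , b , a<x , b≮y , qb<a) =
    let m , qb<m , m<a = ℚ.<-dense qb<a
        r , eq         = over m b b≮y
        b>0            = upper-positive {y} 0<y b≮y
    in r
     , ℚ.*-cancelʳ-<-nonNeg b {{ℚ.pos⇒nonNeg b {{b>0}}}}
         (subst (q ℚ.* b ℚ.<_) (sym eq) qb<m)
     , a , b , a<x , b≮y , subst (ℚ._< a) (sym eq) m<a

  bnd : ∃[ B ] (∀ {q} → Lower q → q ℚ.< B)
  bnd =
    let b₀ , x≤b₀      = bounded x
        c , c>0 , c<y  = positive-lower {y} 0<y
    in bound b₀ x≤b₀ c c>0 c<y
    where
    bound : ∀ b₀ → (∀ {q} → lower x q → q ℚ.< b₀) → ∀ c → ℚ.Positive c →
            lower y c → ∃[ B ] (∀ {q} → Lower q → q ℚ.< B)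
    bound b₀ x≤b₀ c c>0 c<y = M , λ {q} → below q
      where
      instance
        c≢0 : ℚ.NonZero c
        c≢0 = ℚ.pos⇒nonZero c {{c>0}}
        c≥0 : ℚ.NonNegative c
        c≥0 = ℚ.pos⇒nonNeg c {{c>0}}
        1/c≥0 : ℚ.NonNegative (ℚ.1/ c)
        1/c≥0 = ℚ.pos⇒nonNeg (ℚ.1/ c) {{ℚ.1/pos⇒pos c {{c>0}}}}
        b₀⊔0≥0 : ℚ.NonNegative (b₀ ℚ.⊔ 0ℚ)
        b₀⊔0≥0 = ℚ.nonNegative (ℚ.p≤q⊔p b₀ 0ℚ)

      M : ℚ
      M = (b₀ ℚ.⊔ 0ℚ) ℚ.* ℚ.1/ c

      M≥0 : ℚ.NonNegative M
      M≥0 = ℚ.nonNeg*nonNeg⇒nonNeg (b₀ ℚ.⊔ 0ℚ) (ℚ.1/ c)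

      below : ∀ q → Lower q → q ℚ.< M
      below q (a , b , a<x , b≮y , qb<a) = ℚ.≰⇒> λ M≤q →
        ℚ.<-irrefl refl (begin-strict
          q ℚ.* b     <⟨ qb<a ⟩
          a           <⟨ x≤b₀ a<x ⟩
          b₀          ≤⟨ ℚ.p≤p⊔q b₀ 0ℚ ⟩
          b₀ ℚ.⊔ 0ℚ   ≡⟨ *1/-cancel (b₀ ℚ.⊔ 0ℚ) c ⟨
          M ℚ.* c     ≤⟨ ℚ.*-monoʳ-≤-nonNeg c M≤q ⟩
          q ℚ.* c     ≤⟨ ℚ.*-monoˡ-≤-nonNeg q
                           {{ℚ.nonNegative (ℚ.≤-trans (ℚ.nonNegative⁻¹ M {{M≥0}}) M≤q)}}
                           (lower≤upper y c<y b≮y) ⟩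
          q ℚ.* b     ∎)
        where open ℚ.≤-Reasoning

2ℚ : ℚ
2ℚ = ℕ⇒ℚ 2

ℕ⇒ℚ-suc : ∀ k → ℕ⇒ℚ (suc k) ≡ 1ℚ ℚ.+ ℕ⇒ℚ k
ℕ⇒ℚ-suc k = ℚ.toℚᵘ-injective (ℚᵘ.≃-trans (ℚ.toℚᵘ-fromℚᵘ (mkℚᵘ (+ suc k) 0))
  (ℚᵘ.≃-sym (ℚᵘ.≃-trans (ℚ.toℚᵘ-homo-+ 1ℚ (ℕ⇒ℚ k))
    (ℚᵘ.≃-trans (ℚᵘ.+-congʳ (ℚ.toℚᵘ 1ℚ) (ℚ.toℚᵘ-fromℚᵘ (mkℚᵘ (+ k) 0)))
      (*≡* (cong (λ j → (+ 1 ℤ.+ j) ℤ.* + 1) (ℤ.*-identityʳ (+ k))))))))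

ℚ≤ℕ : ∀ p → p ℚ.≤ ℕ⇒ℚ ℤ.∣ ↥ p ∣
ℚ≤ℕ p@record{} = ℚ.toℚᵘ-cancel-≤
  (ℚᵘ.≤-respʳ-≃ (ℚᵘ.≃-sym (ℚ.toℚᵘ-fromℚᵘ (mkℚᵘ (+ ℤ.∣ ↥ p ∣) 0))) (*≤* (ineq (↥ p))))
  where
  ineq : ∀ i → i ℤ.* + 1 ℤ.≤ + ℤ.∣ i ∣ ℤ.* ↧ p
  ineq (+ n)        = subst₂ ℤ._≤_ (ℤ.pos-* n 1) (ℤ.pos-* n (↧ₙ p))
                        (ℤ.+≤+ (ℕ.*-monoʳ-≤ n (s≤s z≤n)))
  ineq ℤ.-[1+ n ]   = subst (ℤ.-[1+ n ] ℤ.* + 1 ℤ.≤_) (ℤ.pos-* (suc n) (↧ₙ p)) ℤ.-≤+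

/≤ℕ : ∀ i d k .{{_ : ℕ.NonZero d}} → i ℤ.≤ + (k ℕ.* d) → i ℚ./ d ℚ.≤ ℕ⇒ℚ k
/≤ℕ i (suc d) k i≤kd = ℚ.toℚᵘ-cancel-≤
  (ℚᵘ.≤-respˡ-≃ (ℚᵘ.≃-sym (ℚ.toℚᵘ-fromℚᵘ (mkℚᵘ i d)))
  (ℚᵘ.≤-respʳ-≃ (ℚᵘ.≃-sym (ℚ.toℚᵘ-fromℚᵘ (mkℚᵘ (+ k) 0)))
  (*≤* (subst₂ ℤ._≤_ (sym (ℤ.*-identityʳ i)) (ℤ.pos-* k (suc d)) i≤kd))))

^-nonNeg : ∀ p .{{_ : ℚ.NonNegative p}} k → ℚ.NonNegative (p ^ k)
^-nonNeg p zero    = _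
^-nonNeg p (suc k) = ℚ.nonNeg*nonNeg⇒nonNeg p (p ^ k) {{^-nonNeg p k}}

^-mono-≤ : ∀ {p q} k .{{_ : ℚ.NonNegative p}} → p ℚ.≤ q → p ^ k ℚ.≤ q ^ k
^-mono-≤         zero    p≤q = ℚ.≤-refl
^-mono-≤ {p} {q} (suc k) p≤q = ℚ.≤-trans
  (ℚ.*-monoˡ-≤-nonNeg p (^-mono-≤ k p≤q))
  (ℚ.*-monoʳ-≤-nonNeg (q ^ k) {{^-nonNeg q {{q≥0}} k}} p≤q)
  where
  q≥0 : ℚ.NonNegative q
  q≥0 = ℚ.nonNegative (ℚ.≤-trans (ℚ.nonNegative⁻¹ p) p≤q)

1≤2^ : ∀ k → 1ℚ ℚ.≤ 2ℚ ^ k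
1≤2^ zero    = ℚ.≤-refl
1≤2^ (suc k) = ℚ.≤-trans (*≤* (ℤ.+≤+ (s≤s z≤n))) (ℚ.*-monoˡ-≤-nonNeg 2ℚ (1≤2^ k))

2^-mono-< : ∀ {j k} → j ℕ.< k → 2ℚ ^ j ℚ.< 2ℚ ^ k
2^-mono-< {zero}  {suc k} _ = ℚ.<-≤-trans (*<* (ℤ.+<+ (s≤s (s≤s z≤n))))
  (ℚ.*-monoˡ-≤-nonNeg 2ℚ (1≤2^ k))
2^-mono-< {suc j} {suc k} (s≤s j<k) = ℚ.*-monoʳ-<-pos 2ℚ (2^-mono-< j<k)

2^-cancel-≤ : ∀ j k → 2ℚ ^ j ℚ.≤ 2ℚ ^ k → j ℕ.≤ k
2^-cancel-≤ j k 2ʲ≤2ᵏ = ℕ.≮⇒≥ λ k<j →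
  ℚ.<-irrefl refl (ℚ.<-≤-trans (2^-mono-< k<j) 2ʲ≤2ᵏ)

ℕ≤2^ : ∀ k → ℕ⇒ℚ k ℚ.≤ 2ℚ ^ k
ℕ≤2^ zero    = *≤* (ℤ.+≤+ z≤n)
ℕ≤2^ (suc k) = begin
  ℕ⇒ℚ (suc k)            ≡⟨ ℕ⇒ℚ-suc k ⟩
  1ℚ ℚ.+ ℕ⇒ℚ k           ≤⟨ ℚ.+-mono-≤ (1≤2^ k) (ℕ≤2^ k) ⟩
  2ℚ ^ k ℚ.+ 2ℚ ^ k      ≡⟨ cong₂ ℚ._+_ (ℚ.*-identityˡ (2ℚ ^ k)) (ℚ.*-identityˡ (2ℚ ^ k)) ⟨
  1ℚ ℚ.* 2ℚ ^ k ℚ.+ 1ℚ ℚ.* 2ℚ ^ k ≡⟨ ℚ.*-distribʳ-+ (2ℚ ^ k) 1ℚ 1ℚ ⟨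
  2ℚ ^ suc k             ∎
  where open ℚ.≤-Reasoning

ℚ≤2^ : ∀ p → p ℚ.≤ 2ℚ ^ ℤ.∣ ↥ p ∣
ℚ≤2^ p = ℚ.≤-trans (ℚ≤ℕ p) (ℕ≤2^ ℤ.∣ ↥ p ∣)

-- For a rational s > 0 and q ≥ 1, (m - k) / q ≤ log₂ s iff 2ᵐ ≤ s^q 2ᵏ;
-- log₂ y is the supremum of such (m - k) / q over 0 < s < y.

log₂ : (y : ℝ) → fromℕ 0 < y → ℝ
log₂ y 0<y = record
  { lower     = Lower
  ; inhabited = inh
  ; bounded   = let b , y≤b = bounded y in bnd b y≤b
  ; closed    = λ p<r (s , s<y , s>0 , q-1 , m , k , ineq , r<mkq) →
      s , s<y , s>0 , q-1 , m , k , ineq , ℚ.<-trans p<r r<mkq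
  ; rounded   = λ (s , s<y , s>0 , q-1 , m , k , ineq , r<mkq) →
      let t , r<t , t<mkq = ℚ.<-dense r<mkq in
      t , r<t , s , s<y , s>0 , q-1 , m , k , ineq , t<mkq
  }
  where
  Lower : ℚ → Set
  Lower r = ∃[ s ] lower y s × ℚ.Positive s × ∃[ q-1 ] ∃[ m ] ∃[ k ]
              2ℚ ^ m ℚ.≤ (s ^ suc q-1) ℚ.* (2ℚ ^ k) ×
              r ℚ.< (m ℤ.⊖ k) ℚ./ suc q-1

  inh : ∃ Lower
  inh = let s , s>0 , s<y = positive-lower {y} 0<y
            k , 1≤s2ᵏ     = large s s>0
            l             = (0 ℤ.⊖ k) ℚ./ 1
        in l ℚ.- 1ℚ , s , s<y , s>0 , 0 , 0 , k
         , subst (λ t → 1ℚ ℚ.≤ t ℚ.* (2ℚ ^ k)) (sym (ℚ.*-identityʳ s)) 1≤s2ᵏ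
         , p-1<p l
    where
    large : ∀ s → ℚ.Positive s → ∃[ k ] 1ℚ ℚ.≤ s ℚ.* 2ℚ ^ k
    large s s>0 = ℤ.∣ ↥ (ℚ.1/ s) ∣ ,
      subst (ℚ._≤ s ℚ.* 2ℚ ^ ℤ.∣ ↥ (ℚ.1/ s) ∣) (ℚ.*-inverseʳ s)
        (ℚ.*-monoˡ-≤-nonNeg s (ℚ≤2^ (ℚ.1/ s)))
      where
      instance
        s≢0 : ℚ.NonZero s
        s≢0 = ℚ.pos⇒nonZero s {{s>0}}
        s≥0 : ℚ.NonNegative s
        s≥0 = ℚ.pos⇒nonNeg s {{s>0}}

  bnd : ∀ b → (∀ {q} → lower y q → q ℚ.< b) → ∃[ B ] (∀ {q} → Lower q → q ℚ.< B)
  bnd b y≤b = ℕ⇒ℚ N , λ { (s , s<y , s>0 , q-1 , m , k , ineq , r<mkq) →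
    ℚ.<-≤-trans r<mkq (/≤ℕ (m ℤ.⊖ k) (suc q-1) N
      (⊖≤ m k (N ℕ.* suc q-1) (exponent s s<y s>0 (suc q-1) m k ineq))) }
    where
    N : ℕ
    N = ℤ.∣ ↥ b ∣

    ⊖≤ : ∀ i j l → i ℕ.≤ l ℕ.+ j → i ℤ.⊖ j ℤ.≤ + l
    ⊖≤ i j l i≤l+j = ℤ.≤-trans (ℤ.⊖-monoˡ-≤ j i≤l+j)
      (ℤ.≤-reflexive (trans (ℤ.⊖-≥ (ℕ.m≤n+m j l)) (cong +_ (ℕ.m+n∸n≡m l j))))

    exponent : ∀ s → lower y s → ℚ.Positive s → ∀ q m k →
      2ℚ ^ m ℚ.≤ (s ^ q) ℚ.* (2ℚ ^ k) → m ℕ.≤ N ℕ.* q ℕ.+ k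
    exponent s s<y s>0 q m k ineq = 2^-cancel-≤ m (N ℕ.* q ℕ.+ k) (begin
      2ℚ ^ m                     ≤⟨ ineq ⟩
      (s ^ q) ℚ.* (2ℚ ^ k)       ≤⟨ ℚ.*-monoʳ-≤-nonNeg (2ℚ ^ k) {{^-nonNeg 2ℚ k}}
                                      (^-mono-≤ q {{ℚ.pos⇒nonNeg s {{s>0}}}}
                                        (ℚ.≤-trans (ℚ.<⇒≤ (y≤b s<y)) (ℚ≤2^ b))) ⟩
      ((2ℚ ^ N) ^ q) ℚ.* (2ℚ ^ k) ≡⟨ cong (ℚ._* (2ℚ ^ k)) (Exp.^-assocʳ 2ℚ N q) ⟩
      (2ℚ ^ (N ℕ.* q)) ℚ.* (2ℚ ^ k) ≡⟨ Exp.^-homo-* 2ℚ (N ℕ.* q) k ⟨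
      2ℚ ^ (N ℕ.* q ℕ.+ k)       ∎)
      where open ℚ.≤-Reasoning

-- Excluded middle decides the order and equality of reals and repairability.

Classical : Setω
Classical = ∀ {ℓ} → ExcludedMiddle ℓ

least : Classical → {P : ℕ → Set} (N : ℕ) → P N →
        Σ[ k ∈ ℕ ] P k × (∀ {j} → P j → k ℕ.≤ j)
least em zero p = zero , p , λ _ → z≤n
least em {P} (suc N) p with em {P = P 0}
... | yes p₀ = zero , p₀ , λ _ → z≤n
... | no ¬p₀ = let k , pₖ , min = least em {P ∘ suc} N p in
  suc k , pₖ , λ { {zero} p₀ → ⊥-elim (¬p₀ p₀) ; {suc j} pⱼ → s≤s (min pⱼ) }

natural-bound : ∀ x → ∃[ N ] (∀ {q} → lower x q → q ℚ.< ℕ⇒ℚ N)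
natural-bound x = let b , x≤b = bounded x in
  ℤ.∣ ↥ b ∣ , λ q<x → ℚ.<-≤-trans (x≤b q<x) (ℚ≤ℕ b)

-- Ceiling (the least k with x ≤ k), cut off at 0 for negative reals.

⌈_⌉ : ℝ → Classical → ℕ
⌈ x ⌉ em = let N , x≤N = natural-bound x in
  proj₁ (least em {λ k → x ≤ fromℕ k} N (λ _ → x≤N))

-- Floor (the least k with x < k + 1), cut off at 0 for negative reals.

⌊_⌋ : ℝ → Classical → ℕ
⌊ x ⌋ em = let N , x≤N = natural-bound x in
  proj₁ (least em {λ k → x < fromℕ (suc k)} N
    ( ℕ⇒ℚ N , (λ N<x → ℚ.<-irrefl refl (x≤N N<x))
    , subst (ℕ⇒ℚ N ℚ.<_) (trans (ℚ.+-comm (ℕ⇒ℚ N) 1ℚ) (sym (ℕ⇒ℚ-suc N)))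
        (p<p+1 (ℕ⇒ℚ N)) ))

private
  variable
    a : Level
    n : ℕ

Sequence : ℕ → Set₁
Sequence n = Fin n → ℝ

-- A subset of ℝ² is a relation that respects equality of reals.

IsLocal : Pred (Sequence n) a → Set (lsuc 0ℓ ⊔ lsuc a)
IsLocal {n} {a} 𝒫 = Σ[ F ∈ Rel ℝ a ] F Respects₂ _≈_ ×
  (∀ f → 𝒫 f ⇔ (∀ (i j : Fin n) → toℕ j ≡ suc (toℕ i) → ¬ F (f i) (f j)))

Unrepairable : Pred (Sequence n) a → Sequence n → Pred (Fin n) 0ℓ → Set (lsuc 0ℓ ⊔ a)
Unrepairable 𝒫 f S = ¬ (∃[ f′ ] (∀ i → S i → f′ i ≈ f i) × 𝒫 f′)

hamming : Classical → Sequence n → Sequence n → ℕ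
hamming {n} em f g = length (filter (λ i → ¬? (em {P = f i ≈ g i})) (allFin n))

Far : Classical → ℝ → Pred (Sequence n) a → Sequence n → Set (lsuc 0ℓ ⊔ a)
Far {n} em ε 𝒫 f = ∀ f′ → 𝒫 f′ → n · ε ≤ fromℕ (hamming em f f′)

-- Finitely supported distributions: outcomes paired with their weights.

Dist : Set → Set
Dist A = List (A × ℚ)

private
  variable
    A B : Set

return : A → Dist A
return x = (x , 1ℚ) ∷ []

infixl 1 _>>=_

_>>=_ : Dist A → (A → Dist B) → Dist B
μ >>= κ = concatMap (λ (x , p) → map (λ (y , q) → y , p ℚ.* q) (κ x)) μ

-- Has total weight 1 only for a nonempty list; the lists sampled from below
-- are nonempty ((0 , d mod n) is in D d n).

uniform : List A → Dist A
uniform []           = []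
uniform xs@(_ ∷ xs′) = map (λ x → x , + 1 ℚ./ suc (length xs′)) xs

independent : (t : ℕ) → Dist A → Dist (Vec A t)
independent zero    μ = return []
independent (suc t) μ = μ >>= λ x → independent t μ >>= λ xs → return (x ∷ xs)

Pr : Dist A → (A → Bool) → ℚ
Pr []            E = 0ℚ
Pr ((x , p) ∷ μ) E = (if E x then p else 0ℚ) ℚ.+ Pr μ E

-- A tester tosses its coins, queries the positions determined by them, and
-- accepts or rejects.  That the verdict uses nothing of f but the answers is
-- the content of Nonadaptive.

record Tester (n : ℕ) : Set₁ where
  field
    Coins   : Set
    coins   : Dist Coins
    queries : Coins → List (Fin n)
    rejects : Coins → Sequence n → Bool

open Tester public

Nonadaptive : Tester n → Set₁
Nonadaptive T = ∀ c f g → (∀ {x} → x ∈ queries T c → f x ≈ g x) →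
  rejects T c f ≡ rejects T c g

record IsNonadaptiveOneSidedTester
         (em : Classical) (𝒫 : Pred (Sequence n) a) (ε : ℝ) (δ : ℚ)
         (T : Tester n) : Set (lsuc 0ℓ ⊔ a) where
  field
    nonadaptive  : Nonadaptive T
    completeness : ∀ f → 𝒫 f → ∀ {c p} → (c , p) ∈ coins T → rejects T c f ≡ false
    soundness    : ∀ f → Far em ε 𝒫 f →
                   1ℚ ℚ.- δ ℚ.≤ Pr (coins T) (λ c → rejects T c f)

-- Positions are numbered from 0, which leaves differences unchanged.

D : ℕ → (n : ℕ) → List (Fin n × Fin n)
D d n = filter (λ (x , y) → + n ∣? (+ toℕ y ℤ.- + toℕ x) ℤ.- + d)
          (cartesianProduct (allFin n) (allFin n))

module _ (em : Classical) (ε : ℝ) (0<ε : fromℕ 0 < ε)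
         (n : ℕ) (4≤nε : fromℕ 4 ≤ n · ε) where

  0<4 : fromℕ 0 < fromℕ 4
  0<4 = 0ℚ , ℚ.<-irrefl refl , ℚ.positive⁻¹ (ℕ⇒ℚ 4)

  0<nε : fromℕ 0 < n · ε
  0<nε = <-≤-trans {fromℕ 0} {fromℕ 4} {n · ε} 0<4 4≤nε

  0<nε/4 : fromℕ 0 < quotient (n · ε) (fromℕ 4) 0<4
  0<nε/4 = 0ℚ , ℚ.<-irrefl refl
         , 2ℚ , ℕ⇒ℚ 4 , 4≤nε 2ℚ (*<* (ℤ.+<+ (s≤s (s≤s (s≤s z≤n)))))
         , ℚ.<-irrefl refl , *<* (ℤ.+<+ (s≤s z≤n))

  maxScale : ℕ
  maxScale = ⌊ log₂ (quotient (n · ε) (fromℕ 4) 0<4) 0<nε/4 ⌋ em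

  iterations : ℕ
  iterations = ⌈ quotient (200 · log₂ (n · ε) 0<nε) ε 0<ε ⌉ em

  samplePair : Dist (Fin n × Fin n)
  samplePair = uniform (upTo (suc maxScale)) >>= λ i → uniform (D (2 ℕ.^ i) n)

  pairTester : Pred (Sequence n) a → Tester n
  pairTester 𝒫 = record
    { Coins   = Vec (Fin n × Fin n) iterations
    ; coins   = independent iterations samplePair
    ; queries = λ c → concatMap (λ (x , y) → x ∷ y ∷ []) (Vec.toList c)
    ; rejects = λ c f → List.any
        (λ (x , y) → does (em {P = Unrepairable 𝒫 f (｛ x ｝ ∪ ｛ y ｝)}))
        (Vec.toList c)
    }

{-# OPTIONS --safe #-}

-- Call x < y linked when f is repairable on {x, y}.  By locality two repairs
-- can be glued at a common point, so links compose, and f is repairable on any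
-- set of pairwise linked points.  Let N be the number of unlinked pairs
-- (u, u + 2ʲ) with j ≤ ℓ.  A point x is good when, summed over j ≤ ℓ, the
-- density of such pairs in the window of length 2ʲ to its right is below 1/2,
-- and likewise to its left; by Markov's inequality at most 4N points are bad.
-- A good x reaches more than half of [x, y] along links of length 2ʲ, a good y
-- is reached from more than half of it, so good points x < y with
-- y - x < 2^(ℓ+1) are linked through a common point.  If 4N < 2^(ℓ+1), the bad
-- points fill no gap of that length, so all good points are linked and f is
-- 4N-close to 𝒫 (or n ≤ 4N); otherwise 16N ≥ 4 · 2^(ℓ+1) ≥ ε n.  Either way
-- N ≥ ε n / 16, so one iteration rejects with probability p ≥ N / ((ℓ + 1) n),
-- and t p ≥ 6 for the t iterations.  By Bernoulli (1 - p)ᵗ ≤ 1 / (1 + t p) ≤ 1/7.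

module Submission where

open import Defs
import Data.Bool.ListAction as Bool
open import Data.Bool.Base using (Bool; true; false; if_then_else_; _∨_)
open import Data.Empty using (⊥-elim)
open import Data.Fin.Base as Fin using (Fin; toℕ; fromℕ<; zero; suc)
import Data.Fin.Properties as Fin
open import Data.Integer.Base as ℤ using (+_)
open import Data.Integer.Divisibility.Signed using (_∣_; _∣?_; divides; ∣m∣n⇒∣m-n; ∣⇒∣ᵤ)
import Data.Integer.Properties as ℤ
import Data.Integer.Tactic.RingSolver as ℤSolver
open import Data.List.Base as List
  using (List; []; _∷_; _++_; map; length; filter; tabulate; upTo; applyUpTo; cartesianProduct; allFin)
open import Data.List.Membership.Propositional using (_∈_)
import Data.List.Properties as List
open import Data.List.Relation.Unary.Any using (here; there)
open import Data.Nat.Base as ℕ using (ℕ; zero; suc; z≤n; s≤s; _+_; _*_; _∸_)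
import Data.Nat.Divisibility as ℕ
import Data.Nat.DivMod as ℕ
import Data.Nat.Properties as ℕ
open import Data.Nat.Tactic.RingSolver using (solve-∀)
open import Data.Product.Base using (∃-syntax; Σ-syntax; _×_; _,_; proj₁; proj₂)
open import Data.Rational.Base as ℚ using (ℚ; 0ℚ; 1ℚ; _/_)
import Data.Rational.Properties as ℚ
open import Data.Rational.Solver using (module +-*-Solver)
open import Data.Rational.Unnormalised.Base using (mkℚᵘ; *≡*)
import Data.Rational.Unnormalised.Properties as ℚᵘ
open import Data.Sum.Base using (_⊎_; inj₁; inj₂; [_,_]′)
open import Data.Vec.Base as Vec using (Vec; []; _∷_)
open import Function.Base using (_∘_; id)
open import Function.Bundles using (_⇔_; mk⇔; Equivalence)
open import Level using (Level; 0ℓ; _⊔_) renaming (suc to lsuc)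
open import Relation.Binary.Construct.Closure.Reflexive as Refl using (ReflClosure; [_])
import Relation.Binary.Construct.Closure.Reflexive.Properties as Refl
open import Relation.Binary.Core using (Rel)
open import Relation.Binary.Definitions using (_Respects₂_)
open import Relation.Binary.PropositionalEquality
open import Relation.Nullary using (¬_; Dec; yes; no; does; ¬?)
open import Relation.Nullary.Decidable using (_×-dec_; decidable-stable; dec-false; does-⇔)
open import Relation.Unary using (Pred; Decidable; _∪_; ｛_｝)
open import Algebra.Properties.Semiring.Sum ℕ.+-*-semiring
  using (sum; ∑-distrib-+; ∑-comm; *-distribˡ-sum; sum-cong-≗; sum-remove)

private
  variable
    a s s′ : Level
    m n : ℕ
    A B : Set
    P : Set a

-- Indicators and finite sums of natural numbers.

𝟙 : Dec P → ℕ
𝟙 d = if does d then 1 else 0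

𝟙≤1 : (d : Dec P) → 𝟙 d ℕ.≤ 1
𝟙≤1 (yes _) = s≤s z≤n
𝟙≤1 (no  _) = z≤n

𝟙-yes : (d : Dec P) → P → 𝟙 d ≡ 1
𝟙-yes (yes _) p = refl
𝟙-yes (no ¬p) p = ⊥-elim (¬p p)

𝟙-no : (d : Dec P) → ¬ P → 𝟙 d ≡ 0
𝟙-no (yes p) ¬p = ⊥-elim (¬p p)
𝟙-no (no _)  ¬p = refl

𝟙-≡0 : (d : Dec P) → 𝟙 d ≡ 0 → ¬ P
𝟙-≡0 (no ¬p) _ = ¬p

𝟙-¬-≡0 : (d : Dec P) → 𝟙 (¬? d) ≡ 0 → P
𝟙-¬-≡0 (yes p) _ = p

𝟙-≤ : ∀ {m} (d : Dec P) → (P → 1 ℕ.≤ m) → 𝟙 d ℕ.≤ m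
𝟙-≤ (yes p) 1≤m = 1≤m p
𝟙-≤ (no _)  _   = z≤n

*𝟙-¬-≤ : ∀ {c w} (d : Dec P) → (¬ P → c ℕ.≤ w) → c * 𝟙 (¬? d) ℕ.≤ w
*𝟙-¬-≤ {c = c} (yes _) _   = ℕ.≤-trans (ℕ.≤-reflexive (ℕ.*-zeroʳ c)) z≤n
*𝟙-¬-≤ {c = c} (no ¬p) c≤w = ℕ.≤-trans (ℕ.≤-reflexive (ℕ.*-identityʳ c)) (c≤w ¬p)

sum-mono : {f g : Fin n → ℕ} → (∀ i → f i ℕ.≤ g i) → sum f ℕ.≤ sum g
sum-mono {zero}  f≤g = z≤n
sum-mono {suc n} f≤g = ℕ.+-mono-≤ (f≤g zero) (sum-mono (f≤g ∘ suc))

sum-const : ∀ n c → sum {n} (λ _ → c) ≡ n * c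
sum-const zero    c = refl
sum-const (suc n) c = cong (c ℕ.+_) (sum-const n c)

term≤sum : (f : Fin n → ℕ) (i : Fin n) → f i ℕ.≤ sum f
term≤sum f zero    = ℕ.m≤m+n (f zero) _
term≤sum f (suc i) = ℕ.≤-trans (term≤sum (f ∘ suc) i) (ℕ.m≤n+m _ (f zero))

Σ< : ℕ → (ℕ → ℕ) → ℕ
Σ< n g = sum {n} (g ∘ toℕ)

Σ<-mono : ∀ n {f g} → (∀ k → k ℕ.< n → f k ℕ.≤ g k) → Σ< n f ℕ.≤ Σ< n g
Σ<-mono n f≤g = sum-mono λ i → f≤g (toℕ i) (Fin.toℕ<n i)

Σ<-split : ∀ m n g → Σ< (m + n) g ≡ Σ< m g + Σ< n (λ k → g (m + k))
Σ<-split zero    n g = refl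
Σ<-split (suc m) n g = trans (cong (g 0 ℕ.+_) (Σ<-split m n (g ∘ suc)))
  (sym (ℕ.+-assoc (g 0) _ _))

Σ<-last : ∀ n g → Σ< (suc n) g ≡ Σ< n g + g n
Σ<-last zero    g = ℕ.+-identityʳ (g 0)
Σ<-last (suc n) g = trans (cong (g 0 ℕ.+_) (Σ<-last n (g ∘ suc)))
  (sym (ℕ.+-assoc (g 0) _ _))

Σ<-+ : ∀ n f g → Σ< n (λ k → f k + g k) ≡ Σ< n f + Σ< n g
Σ<-+ n f g = ∑-distrib-+ {n} (f ∘ toℕ) (g ∘ toℕ)

Σ<-extend : ∀ {m n} g → m ℕ.≤ n → Σ< m g ℕ.≤ Σ< n g
Σ<-extend {m} {n} g m≤n = subst (λ k → Σ< m g ℕ.≤ Σ< k g) (ℕ.m+[n∸m]≡n m≤n)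
  (ℕ.≤-trans (ℕ.m≤m+n _ _) (ℕ.≤-reflexive (sym (Σ<-split m (n ∸ m) g))))

Σ<-reverse : ∀ n g → Σ< (suc n) (λ k → g (n ∸ k)) ≡ Σ< (suc n) g
Σ<-reverse zero    g = refl
Σ<-reverse (suc n) g = begin
  g (suc n) + Σ< (suc n) (λ k → g (n ∸ k)) ≡⟨ cong (g (suc n) ℕ.+_) (Σ<-reverse n g) ⟩
  g (suc n) + Σ< (suc n) g                 ≡⟨ ℕ.+-comm (g (suc n)) _ ⟩
  Σ< (suc n) g + g (suc n)                 ≡⟨ Σ<-last (suc n) g ⟨
  Σ< (suc (suc n)) g                       ∎
  where open ≡-Reasoning

-- Pigeonhole: `n` nonzero terms would add up to at least `n`.
Σ<-zero-term : ∀ n g → Σ< n g ℕ.< n → ∃[ k ] k ℕ.< n × g k ≡ 0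
Σ<-zero-term (suc n) g Σ<n with g 0 in eq
... | zero  = 0 , s≤s z≤n , eq
... | suc _ =
  let k , k<n , gk≡0 = Σ<-zero-term n (g ∘ suc)
                         (ℕ.s≤s⁻¹ (ℕ.≤-trans (s≤s (s≤s (ℕ.m≤n+m _ _))) Σ<n))
  in suc k , s≤s k<n , gk≡0

-- The shifted window drops the first `k` terms and gains only terms at `n` or beyond, which vanish.
Σ<-forward : ∀ n {g} k → (∀ u → n ℕ.≤ u → g u ≡ 0) → Σ< n (λ x → g (x + k)) ℕ.≤ Σ< n g
Σ<-forward n {g} k g-out = begin
  Σ< n (λ x → g (x + k))  ≡⟨ sum-cong-≗ {n} (λ i → cong g (ℕ.+-comm (toℕ i) k)) ⟩
  Σ< n (λ x → g (k + x))  ≤⟨ ℕ.m≤n+m _ _ ⟩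
  Σ< k g + Σ< n (λ x → g (k + x)) ≡⟨ Σ<-split k n g ⟨
  Σ< (k + n) g            ≡⟨ cong (λ l → Σ< l g) (ℕ.+-comm k n) ⟩
  Σ< (n + k) g            ≡⟨ Σ<-split n k g ⟩
  Σ< n g + Σ< k (λ x → g (n + x)) ≡⟨ cong (Σ< n g ℕ.+_) (sum-cong-≗ {k} (λ i → g-out _ (ℕ.m≤m+n n _))) ⟩
  Σ< n g + Σ< k (λ _ → 0) ≡⟨ cong (Σ< n g ℕ.+_) (trans (sum-const k 0) (ℕ.*-zeroʳ k)) ⟩
  Σ< n g + 0              ≡⟨ ℕ.+-identityʳ _ ⟩
  Σ< n g                  ∎
  where open ℕ.≤-Reasoning

-- back s g y is g (y - s), and 0 (not g 0) when y < s.

back : ℕ → (ℕ → ℕ) → ℕ → ℕ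
back zero    g y       = g y
back (suc s) g zero    = 0
back (suc s) g (suc y) = back s g y

back-+ : ∀ s g u → back s g (s + u) ≡ g u
back-+ zero    g u = refl
back-+ (suc s) g u = back-+ s g u

Σ<-back : ∀ n s g → Σ< n (back s g) ℕ.≤ Σ< n g
Σ<-back n       zero    g = ℕ.≤-refl
Σ<-back zero    (suc s) g = z≤n
Σ<-back (suc n) (suc s) g = ℕ.≤-trans (Σ<-back n s g) (Σ<-extend g (ℕ.n≤1+n n))

-- Reachability along edges of dyadic length.

-- If w j k indicates a missing edge k → 2ʲ + k, then weight w J is 2ᴶ⁻¹ times
-- the sum over j < J of the density of the missing edges starting in [0, 2ʲ).

weight : (ℕ → ℕ → ℕ) → ℕ → ℕ
weight w zero    = 0
weight w (suc j) = 2 * weight w j + Σ< (2 ℕ.^ j) (w j)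

-- The offset `2 ^ j + k` is unreached only if `k` is unreached or the edge between them is missing.
-- Doubling the window therefore doubles the count of unreached offsets and adds the missing edges
-- of scale `j`, which is the recursion of `weight`.
unreached≤weight : {R : ℕ → Set a} (R? : ∀ k → Dec (R k)) (w : ℕ → ℕ → ℕ) → R 0 →
  (∀ j k → R k → w j k ≡ 0 → R (2 ℕ.^ j + k)) →
  ∀ J → Σ< (2 ℕ.^ J) (λ k → 𝟙 (¬? (R? k))) ℕ.≤ weight w J
unreached≤weight R? w R0 step zero    = ℕ.≤-reflexive
  (trans (ℕ.+-identityʳ _) (𝟙-no (¬? (R? 0)) (λ ¬R0 → ¬R0 R0)))
unreached≤weight {R = R} R? w R0 step (suc j) = begin
  Σ< (2 ℕ.^ suc j) g                      ≡⟨ cong (λ l → Σ< (2ʲ + l) g) (ℕ.+-identityʳ 2ʲ) ⟩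
  Σ< (2ʲ + 2ʲ) g                          ≡⟨ Σ<-split 2ʲ 2ʲ g ⟩
  Σ< 2ʲ g + Σ< 2ʲ (λ k → g (2ʲ + k))      ≤⟨ ℕ.+-monoʳ-≤ (Σ< 2ʲ g) (Σ<-mono 2ʲ (λ k _ → new k)) ⟩
  Σ< 2ʲ g + Σ< 2ʲ (λ k → g k + w j k)     ≡⟨ cong (Σ< 2ʲ g ℕ.+_) (Σ<-+ 2ʲ g (w j)) ⟩
  Σ< 2ʲ g + (Σ< 2ʲ g + Σ< 2ʲ (w j))       ≡⟨ double (Σ< 2ʲ g) _ ⟩
  2 * Σ< 2ʲ g + Σ< 2ʲ (w j)               ≤⟨ ℕ.+-monoˡ-≤ _ (ℕ.*-monoʳ-≤ 2 (unreached≤weight R? w R0 step j)) ⟩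
  weight w (suc j)                        ∎
  where
  open ℕ.≤-Reasoning

  2ʲ : ℕ
  2ʲ = 2 ℕ.^ j

  g : ℕ → ℕ
  g k = 𝟙 (¬? (R? k))

  double : ∀ x y → x + (x + y) ≡ 2 * x + y
  double = solve-∀

  new : ∀ k → g (2ʲ + k) ℕ.≤ g k + w j k
  new k with R? k | w j k in eq
  ... | no _   | _     = ℕ.≤-trans (𝟙≤1 (¬? (R? (2ʲ + k)))) (s≤s z≤n)
  ... | yes Rk | zero  = ℕ.≤-reflexive (𝟙-no (¬? (R? (2ʲ + k))) (λ ¬R → ¬R (step j k Rk eq)))
  ... | yes Rk | suc _ = ℕ.≤-trans (𝟙≤1 (¬? (R? (2ʲ + k)))) (s≤s z≤n)

-- Relative to 2ᴶ the weight never decreases with `J`, since each step adds a nonnegative density.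
weight-scale : ∀ w d J → 2 ℕ.^ d * weight w J ℕ.≤ weight w (d + J)
weight-scale w zero    J = ℕ.≤-reflexive (ℕ.*-identityˡ _)
weight-scale w (suc d) J = begin
  2 * 2 ℕ.^ d * weight w J    ≡⟨ ℕ.*-assoc 2 (2 ℕ.^ d) _ ⟩
  2 * (2 ℕ.^ d * weight w J)  ≤⟨ ℕ.*-monoʳ-≤ 2 (weight-scale w d J) ⟩
  2 * weight w (d + J)        ≤⟨ ℕ.m≤m+n _ _ ⟩
  weight w (suc d + J)        ∎
  where open ℕ.≤-Reasoning

-- After exchanging sums, each offset below `2 ^ J` contributes at most `N J` over all points. The
-- leading 2 matches the normalisation of `weight` by 2ᴶ⁻¹.
sum-weight : ∀ n (w : ℕ → ℕ → ℕ → ℕ) (N : ℕ → ℕ) →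
  (∀ j k → Σ< n (λ x → w x j k) ℕ.≤ N j) →
  ∀ J → 2 * Σ< n (λ x → weight (w x) J) ℕ.≤ 2 ℕ.^ J * Σ< J N
sum-weight n w N w≤N zero    = ℕ.≤-reflexive (cong (2 *_) (trans (sum-const n 0) (ℕ.*-zeroʳ n)))
sum-weight n w N w≤N (suc J) = begin
  2 * Σ< n (λ x → 2 * weight (w x) J + Σ< 2ᴶ (w x J))
    ≡⟨ cong (2 *_) (Σ<-+ n (λ x → 2 * weight (w x) J) (λ x → Σ< 2ᴶ (w x J))) ⟩
  2 * (Σ< n (λ x → 2 * weight (w x) J) + Σ< n (λ x → Σ< 2ᴶ (w x J)))
    ≡⟨ cong (λ s → 2 * (s + Σ< n (λ x → Σ< 2ᴶ (w x J)))) (sym (*-distribˡ-sum {n} 2 _)) ⟩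
  2 * (2 * Σ< n (λ x → weight (w x) J) + Σ< n (λ x → Σ< 2ᴶ (w x J)))
    ≤⟨ ℕ.*-monoʳ-≤ 2 (ℕ.+-mono-≤ (sum-weight n w N w≤N J) edges) ⟩
  2 * (2ᴶ * Σ< J N + 2ᴶ * N J)
    ≡⟨ cong (2 *_) (sym (ℕ.*-distribˡ-+ 2ᴶ _ _)) ⟩
  2 * (2ᴶ * (Σ< J N + N J))
    ≡⟨ ℕ.*-assoc 2 2ᴶ _ ⟨
  2 ℕ.^ suc J * (Σ< J N + N J)
    ≡⟨ cong (2 ℕ.^ suc J *_) (Σ<-last J N) ⟨
  2 ℕ.^ suc J * Σ< (suc J) N ∎
  where
  open ℕ.≤-Reasoning

  2ᴶ : ℕ
  2ᴶ = 2 ℕ.^ J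

  edges : Σ< n (λ x → Σ< 2ᴶ (w x J)) ℕ.≤ 2ᴶ * N J
  edges = begin
    Σ< n (λ x → Σ< 2ᴶ (w x J))        ≡⟨ ∑-comm {n} {2ᴶ} (λ x k → w (toℕ x) J (toℕ k)) ⟩
    Σ< 2ᴶ (λ k → Σ< n (λ x → w x J k)) ≤⟨ Σ<-mono 2ᴶ (λ k _ → w≤N J k) ⟩
    Σ< 2ᴶ (λ _ → N J)                 ≡⟨ sum-const 2ᴶ (N J) ⟩
    2ᴶ * N J                          ∎

-- The least power of two above `m` is at most `2 * m`, so a dyadic window that covers an interval
-- need not be more than about twice as long.
<-dyadic : ∀ L m → 0 ℕ.< m → m ℕ.< 2 ℕ.^ L →
  ∃[ J ] J ℕ.≤ L × m ℕ.< 2 ℕ.^ J × 2 ℕ.^ J ℕ.≤ 2 * m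
<-dyadic zero    zero    () _
<-dyadic zero    (suc m) _  (s≤s ())
<-dyadic (suc L) m 0<m m<2ᴸ⁺¹ with m ℕ.<? 2 ℕ.^ L
... | yes m<2ᴸ = let J , J≤L , rest = <-dyadic L m 0<m m<2ᴸ in J , ℕ.m≤n⇒m≤1+n J≤L , rest
... | no  m≮2ᴸ = suc L , ℕ.≤-refl , m<2ᴸ⁺¹ , ℕ.*-monoʳ-≤ 2 (ℕ.≮⇒≥ m≮2ᴸ)

-- Good and bad points of a transitive relation checked at dyadic distances.

module SpotCheck (em : Classical) {q : Level} {Q : ℕ → ℕ → Set q}
  (Q-trans : ∀ {x y z} → Q x y → Q y z → Q x z)
  (n : ℕ) (v : ℕ → ℕ → ℕ)
  (v-out : ∀ j u → n ℕ.≤ u → v j u ≡ 0)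
  (v-edge : ∀ j u → v j u ≡ 0 → 2 ℕ.^ j + u ℕ.< n → Q u (2 ℕ.^ j + u))
  where

  -- Offset 0 has to count as reached although `Q` may be irreflexive.
  Q⁼ : ℕ → ℕ → Set q
  Q⁼ = ReflClosure Q

  Q⁼-trans : ∀ {x y z} → Q⁼ x y → Q⁼ y z → Q⁼ x z
  Q⁼-trans = Refl.trans Q-trans

  strict : ∀ {x y} → x ≢ y → Q⁼ x y → Q x y
  strict x≢y Refl.refl = ⊥-elim (x≢y refl)
  strict x≢y [ xQy ]   = xQy

  -- Seen from `y` to the left, the edge from offset `k` to offset `2 ^ j + k` starts at the
  -- position `y - (2 ^ j + k)`, hence the `back` in `w⁻`.
  w⁺ w⁻ : ℕ → ℕ → ℕ → ℕ
  w⁺ x j k = v j (x + k)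
  w⁻ y j k = back (2 ℕ.^ j + k) (v j) y

  -- Offsets k that leave [0, n) count as reached.

  R⁺ R⁻ : ℕ → ℕ → Set q
  R⁺ x k = x + k ℕ.< n → Q⁼ x (x + k)
  R⁻ y k = ∀ u → k + u ≡ y → Q⁼ u y

  u⁺ u⁻ : ℕ → ℕ → ℕ
  u⁺ x k = 𝟙 (¬? (em {P = R⁺ x k}))
  u⁻ y k = 𝟙 (¬? (em {P = R⁻ y k}))

  u⁺≤weight : ∀ x J → Σ< (2 ℕ.^ J) (u⁺ x) ℕ.≤ weight (w⁺ x) J
  u⁺≤weight x = unreached≤weight (λ k → em) (w⁺ x)
    (λ _ → subst (Q⁼ x) (sym (ℕ.+-identityʳ x)) Refl.refl) step
    where
    swap : ∀ x d k → d + (x + k) ≡ x + (d + k)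
    swap = solve-∀

    step : ∀ j k → R⁺ x k → w⁺ x j k ≡ 0 → R⁺ x (2 ℕ.^ j + k)
    step j k r e lt =
      let lt′ = subst (ℕ._< n) (sym (swap x (2 ℕ.^ j) k)) lt in
      Q⁼-trans (r (ℕ.≤-<-trans (ℕ.m≤n+m (x + k) (2 ℕ.^ j)) lt′))
        (subst (Q⁼ (x + k)) (swap x (2 ℕ.^ j) k) [ v-edge j (x + k) e lt′ ])

  u⁻≤weight : ∀ y → y ℕ.< n → ∀ J → Σ< (2 ℕ.^ J) (u⁻ y) ℕ.≤ weight (w⁻ y) J
  u⁻≤weight y y<n = unreached≤weight (λ k → em) (w⁻ y)
    (λ u u≡y → subst (λ z → Q⁼ z y) (sym u≡y) Refl.refl) step
    where
    swap : ∀ d k u → k + (d + u) ≡ d + k + u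
    swap = solve-∀

    step : ∀ j k → R⁻ y k → w⁻ y j k ≡ 0 → R⁻ y (2 ℕ.^ j + k)
    step j k r e u refl =
      let d+u<n = ℕ.≤-<-trans (ℕ.≤-trans (ℕ.m≤n+m _ k) (ℕ.≤-reflexive (swap (2 ℕ.^ j) k u))) y<n
      in Q⁼-trans [ v-edge j u (trans (sym (back-+ (2 ℕ.^ j + k) (v j) u)) e) d+u<n ]
           (r (2 ℕ.^ j + u) (swap (2 ℕ.^ j) k u))

  module _ (L : ℕ) where

    N : ℕ
    N = Σ< L (λ j → Σ< n (v j))

    -- Each of the two sums of densities is below 1/2; see weight.

    Good : ℕ → Set
    Good x = 4 * weight (w⁺ x) L ℕ.< 2 ℕ.^ L × 4 * weight (w⁻ x) L ℕ.< 2 ℕ.^ L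

    good? : ∀ x → Dec (Good x)
    good? x = (4 * weight (w⁺ x) L ℕ.<? 2 ℕ.^ L) ×-dec (4 * weight (w⁻ x) L ℕ.<? 2 ℕ.^ L)

    bad : ℕ → ℕ
    bad x = 𝟙 (¬? (good? x))

    -- Markov's inequality: a bad point has four times its two weights summing to at least `2 ^ L`,
    -- while by `sum-weight` twice the total of either weight is at most `2 ^ L * N`.
    #bad≤4N : Σ< n bad ℕ.≤ 4 * N
    #bad≤4N = ℕ.*-cancelˡ-≤ S {{ℕ.m^n≢0 2 L}} (begin
      S * Σ< n bad                       ≡⟨ *-distribˡ-sum {n} S _ ⟩
      Σ< n (λ x → S * bad x)             ≤⟨ Σ<-mono n (λ x _ → markov x) ⟩
      Σ< n (λ x → 4 * (weight (w⁺ x) L + weight (w⁻ x) L)) ≡⟨ *-distribˡ-sum {n} 4 _ ⟨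
      4 * Σ< n (λ x → weight (w⁺ x) L + weight (w⁻ x) L)
        ≡⟨ cong (4 *_) (Σ<-+ n (λ x → weight (w⁺ x) L) (λ x → weight (w⁻ x) L)) ⟩
      4 * (Σ< n (λ x → weight (w⁺ x) L) + Σ< n (λ x → weight (w⁻ x) L))
        ≡⟨ regroup (Σ< n (λ x → weight (w⁺ x) L)) _ ⟩
      2 * (2 * Σ< n (λ x → weight (w⁺ x) L) + 2 * Σ< n (λ x → weight (w⁻ x) L))
        ≤⟨ ℕ.*-monoʳ-≤ 2 (ℕ.+-mono-≤
             (sum-weight n w⁺ _ (λ j k → Σ<-forward n k (v-out j)) L)
             (sum-weight n w⁻ _ (λ j k → Σ<-back n (2 ℕ.^ j + k) (v j)) L)) ⟩
      2 * (S * N + S * N)                ≡⟨ regroup′ S N ⟩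
      S * (4 * N)                        ∎)
      where
      open ℕ.≤-Reasoning

      S : ℕ
      S = 2 ℕ.^ L

      regroup : ∀ x y → 4 * (x + y) ≡ 2 * (2 * x + 2 * y)
      regroup = solve-∀

      regroup′ : ∀ x y → 2 * (x * y + x * y) ≡ x * (4 * y)
      regroup′ = solve-∀

      markov : ∀ x → S * bad x ℕ.≤ 4 * (weight (w⁺ x) L + weight (w⁻ x) L)
      markov x = *𝟙-¬-≤ (good? x) λ ¬g → ℕ.≮⇒≥ λ lt → ¬g
        ( ℕ.≤-<-trans (ℕ.*-monoʳ-≤ 4 (ℕ.m≤m+n (weight (w⁺ x) L) _)) lt
        , ℕ.≤-<-trans (ℕ.*-monoʳ-≤ 4 (ℕ.m≤n+m (weight (w⁻ x) L) (weight (w⁺ x) L))) lt )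

    -- By `weight-scale`, a relative weight below 1/4 at the top scale `L` is below 1/4 at every
    -- smaller scale, so `Good` controls all windows at once.
    light : ∀ {w} → 4 * weight w L ℕ.< 2 ℕ.^ L → ∀ {J s} → J ℕ.≤ L → s ℕ.≤ weight w J →
      4 * s ℕ.< 2 ℕ.^ J
    light {w} wL<S {J} {s} J≤L s≤ = ℕ.*-cancelˡ-< (2 ℕ.^ d) _ _ (begin-strict
      2 ℕ.^ d * (4 * s)           ≤⟨ ℕ.*-monoʳ-≤ (2 ℕ.^ d) (ℕ.*-monoʳ-≤ 4 s≤) ⟩
      2 ℕ.^ d * (4 * weight w J)  ≡⟨ swap (2 ℕ.^ d) (weight w J) ⟩
      4 * (2 ℕ.^ d * weight w J)  ≤⟨ ℕ.*-monoʳ-≤ 4 (weight-scale w d J) ⟩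
      4 * weight w (d + J)        ≡⟨ cong (λ l → 4 * weight w l) (ℕ.m∸n+n≡m J≤L) ⟩
      4 * weight w L              <⟨ wL<S ⟩
      2 ℕ.^ L                     ≡⟨ cong (2 ℕ.^_) (ℕ.m∸n+n≡m J≤L) ⟨
      2 ℕ.^ (d + J)               ≡⟨ ℕ.^-distribˡ-+-* 2 d J ⟩
      2 ℕ.^ d * 2 ℕ.^ J           ∎)
      where
      open ℕ.≤-Reasoning

      d : ℕ
      d = L ∸ J

      swap : ∀ x y → x * (4 * y) ≡ 4 * (x * y)
      swap = solve-∀

    -- In the least dyadic window covering `m = y - x`, fewer than a quarter of the offsets are
    -- unreached from `x`, and likewise for `y`. Together they are at most `m` of the `m + 1` points
    -- from `x` to `y`, so some point is reached from `x` and reaches `y`.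
    Q-near : ∀ {x y} → Good x → Good y → x ℕ.< y → y ℕ.< 2 ℕ.^ L + x → y ℕ.< n → Q x y
    Q-near {x} (g⁺ , _) (_ , g⁻) x<y y<S+x y<n
      with m , refl ← ℕ.m≤n⇒∃[o]m+o≡n (ℕ.<⇒≤ x<y) =
      let J , J≤L , m<2ᴶ , 2ᴶ≤2m = <-dyadic L m
            (ℕ.+-cancelˡ-< x _ _ (ℕ.≤-<-trans (ℕ.≤-reflexive (ℕ.+-identityʳ x)) x<y))
            (ℕ.+-cancelˡ-< x _ _ (ℕ.<-≤-trans y<S+x (ℕ.≤-reflexive (ℕ.+-comm _ x))))
          k , k≤m , gk≡0 = Σ<-zero-term (suc m) g (few J J≤L m<2ᴶ 2ᴶ≤2m)
          R⁺k = 𝟙-¬-≡0 em (ℕ.m+n≡0⇒m≡0 (u⁺ x k) gk≡0)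
          R⁻k = 𝟙-¬-≡0 em (ℕ.m+n≡0⇒n≡0 (u⁺ x k) gk≡0)
          k≤m′ = ℕ.s≤s⁻¹ k≤m
      in strict (ℕ.<⇒≢ x<y)
           (Q⁼-trans (R⁺k (ℕ.≤-<-trans (ℕ.+-monoʳ-≤ x k≤m′) y<n))
                     (R⁻k (x + k) (offset k k≤m′)))
      where
      g : ℕ → ℕ
      -- The point at offset `k` from `x` is at offset `m ∸ k` from `y`.
      g k = u⁺ x k + u⁻ (x + m) (m ∸ k)

      offset : ∀ k → k ℕ.≤ m → m ∸ k + (x + k) ≡ x + m
      offset k k≤m = trans (swap (m ∸ k) x k) (cong (x ℕ.+_) (ℕ.m∸n+n≡m k≤m))
        where
        swap : ∀ a b c → a + (b + c) ≡ b + (a + c)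
        swap = solve-∀

      few : ∀ J → J ℕ.≤ L → m ℕ.< 2 ℕ.^ J → 2 ℕ.^ J ℕ.≤ 2 * m → Σ< (suc m) g ℕ.< suc m
      few J J≤L m<2ᴶ 2ᴶ≤2m = s≤s (ℕ.*-cancelˡ-≤ 4 (begin
        4 * Σ< (suc m) g
          ≡⟨ cong (4 *_) (Σ<-+ (suc m) (u⁺ x) (λ k → u⁻ (x + m) (m ∸ k))) ⟩
        4 * (Σ< (suc m) (u⁺ x) + Σ< (suc m) (λ k → u⁻ (x + m) (m ∸ k)))
          ≡⟨ cong (λ s → 4 * (Σ< (suc m) (u⁺ x) + s)) (Σ<-reverse m (u⁻ (x + m))) ⟩
        4 * (Σ< (suc m) (u⁺ x) + Σ< (suc m) (u⁻ (x + m)))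
          ≤⟨ ℕ.*-monoʳ-≤ 4 (ℕ.+-mono-≤ (Σ<-extend (u⁺ x) m<2ᴶ) (Σ<-extend (u⁻ (x + m)) m<2ᴶ)) ⟩
        4 * (Σ< (2 ℕ.^ J) (u⁺ x) + Σ< (2 ℕ.^ J) (u⁻ (x + m)))
          ≡⟨ ℕ.*-distribˡ-+ 4 (Σ< (2 ℕ.^ J) (u⁺ x)) _ ⟩
        4 * Σ< (2 ℕ.^ J) (u⁺ x) + 4 * Σ< (2 ℕ.^ J) (u⁻ (x + m))
          ≤⟨ ℕ.+-mono-≤ (ℕ.<⇒≤ (light {w⁺ x} g⁺ J≤L (u⁺≤weight x J)))
                        (ℕ.<⇒≤ (light {w⁻ (x + m)} g⁻ J≤L (u⁻≤weight (x + m) y<n J))) ⟩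
        2 ℕ.^ J + 2 ℕ.^ J
          ≤⟨ ℕ.+-mono-≤ 2ᴶ≤2m 2ᴶ≤2m ⟩
        2 * m + 2 * m
          ≡⟨ regroup m ⟩
        4 * m ∎))
        where
        open ℕ.≤-Reasoning

        regroup : ∀ m → 2 * m + 2 * m ≡ 4 * m
        regroup = solve-∀

    -- Four times a positive natural is never below 2, so in a light window of length 2 nothing is
    -- unreached.
    first-unit≡0 : ∀ {u : ℕ → ℕ} → 4 * Σ< 2 u ℕ.< 2 → u 1 ≡ 0
    first-unit≡0 {u} lt with Σ< 2 u in eq
    ... | zero  = ℕ.n≤0⇒n≡0 (ℕ.≤-trans (term≤sum {2} (u ∘ toℕ) (suc zero)) (ℕ.≤-reflexive eq))
    ... | suc s = ⊥-elim (ℕ.≤⇒≯ (ℕ.≤-trans (s≤s (s≤s z≤n)) (ℕ.*-monoʳ-≤ 4 (s≤s (z≤n {s})))) lt)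

    -- The neighbour may be bad: this link serves to repair the sequence at the single point `x`.
    Q-suc : ∀ x → 0 ℕ.< L → Good x → suc x ℕ.< n → Q x (suc x)
    Q-suc x 0<L (g⁺ , _) x+1<n = subst (Q x) (ℕ.+-comm x 1)
      (strict (ℕ.<⇒≢ (ℕ.m<m+n x (s≤s z≤n)))
        (𝟙-¬-≡0 em (first-unit≡0 {u⁺ x} (light {w⁺ x} g⁺ 0<L (u⁺≤weight x 1)))
          (subst (ℕ._< n) (ℕ.+-comm 1 x) x+1<n)))

    Q-pred : ∀ x → 0 ℕ.< L → Good (suc x) → suc x ℕ.< n → Q x (suc x)
    Q-pred x 0<L (_ , g⁻) x+1<n = strict (ℕ.<⇒≢ (ℕ.n<1+n x))
      (𝟙-¬-≡0 em (first-unit≡0 {u⁻ (suc x)}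
        (light {w⁻ (suc x)} g⁻ 0<L (u⁻≤weight (suc x) x+1<n 1))) x refl)

  module _ (ℓ : ℕ) (4N<2ᴸ : 4 * N (suc ℓ) ℕ.< 2 ℕ.^ suc ℓ) where

    -- Both sides of 4N < 2ᴸ are even, so at most 2ᴸ - 2 points are bad: too few
    -- to fill the gap between two points at distance 2ᴸ.

    #bad+2≤2ᴸ : 2 + Σ< n (bad (suc ℓ)) ℕ.≤ 2 ℕ.^ suc ℓ
    #bad+2≤2ᴸ = begin
      2 + Σ< n (bad (suc ℓ))  ≤⟨ ℕ.+-monoʳ-≤ 2 (#bad≤4N (suc ℓ)) ⟩
      2 + 4 * N (suc ℓ)       ≡⟨ even (N (suc ℓ)) ⟩
      2 * suc (2 * N (suc ℓ)) ≤⟨ ℕ.*-monoʳ-≤ 2 (ℕ.*-cancelˡ-< 2 (2 * N (suc ℓ)) (2 ℕ.^ ℓ)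
                                   (ℕ.≤-<-trans (ℕ.≤-reflexive (four (N (suc ℓ)))) 4N<2ᴸ)) ⟩
      2 ℕ.^ suc ℓ             ∎
      where
      open ℕ.≤-Reasoning

      even : ∀ N → 2 + 4 * N ≡ 2 * suc (2 * N)
      even = solve-∀

      four : ∀ N → 2 * (2 * N) ≡ 4 * N
      four = solve-∀

    good-between : ∀ x y → 2 ℕ.^ suc ℓ + x ℕ.≤ y → y ℕ.≤ n →
      ∃[ z ] x ℕ.< z × z ℕ.< y × Good (suc ℓ) z
    good-between x y S+x≤y y≤n
      with p , refl ← ℕ.m≤n⇒∃[o]m+o≡n
             (ℕ.≤-trans (ℕ.+-monoˡ-≤ x (ℕ.m^n>0 2 (suc ℓ))) S+x≤y) =
      let k , k<p , b≡0 = Σ<-zero-term p (λ k → bad (suc ℓ) (suc x + k)) few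
      in suc x + k , s≤s (ℕ.m≤m+n x k) , ℕ.+-monoʳ-< (suc x) k<p
       , 𝟙-¬-≡0 (good? (suc ℓ) (suc x + k)) b≡0
      where
      open ℕ.≤-Reasoning

      few : Σ< p (λ k → bad (suc ℓ) (suc x + k)) ℕ.< p
      -- There are `p = y - x - 1` points strictly between, and
      -- `2 + #bad ≤ 2 ^ suc ℓ ≤ y - x = p + 1`. The summand 2 pays for the lost endpoint and for
      -- strictness.
      few = ℕ.s≤s⁻¹ (begin
        2 + Σ< p (λ k → bad (suc ℓ) (suc x + k))
          ≤⟨ ℕ.+-monoʳ-≤ 2 (ℕ.m≤n+m _ (Σ< (suc x) (bad (suc ℓ)))) ⟩
        2 + (Σ< (suc x) (bad (suc ℓ)) + Σ< p (λ k → bad (suc ℓ) (suc x + k)))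
          ≡⟨ cong (2 ℕ.+_) (Σ<-split (suc x) p (bad (suc ℓ))) ⟨
        2 + Σ< (suc x + p) (bad (suc ℓ))
          ≤⟨ ℕ.+-monoʳ-≤ 2 (Σ<-extend (bad (suc ℓ)) y≤n) ⟩
        2 + Σ< n (bad (suc ℓ))
          ≤⟨ #bad+2≤2ᴸ ⟩
        2 ℕ.^ suc ℓ
          ≤⟨ ℕ.+-cancelʳ-≤ x _ _ (ℕ.≤-trans S+x≤y (ℕ.≤-reflexive (cong suc (ℕ.+-comm x p)))) ⟩
        suc p ∎)

    -- Near pairs are linked by `Q-near`; a far pair is split at a good point strictly between, and
    -- transitivity joins the halves. The induction is on a bound `b` for the distance, which drops
    -- in both halves.
    Q-good : ∀ {x y} → Good (suc ℓ) x → Good (suc ℓ) y → x ℕ.< y → y ℕ.< n → Q x y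
    Q-good {x} {y} gx gy x<y y<n = within y gx gy x<y (ℕ.m≤m+n y x) y<n
      where
      within : ∀ b {x y} → Good (suc ℓ) x → Good (suc ℓ) y → x ℕ.< y → y ℕ.≤ b + x →
        y ℕ.< n → Q x y
      within zero    gx gy x<y y≤x y<n = ⊥-elim (ℕ.<⇒≱ x<y y≤x)
      within (suc b) {x} {y} gx gy x<y y≤b+x y<n with y ℕ.<? 2 ℕ.^ suc ℓ + x
      ... | yes near = Q-near (suc ℓ) gx gy x<y near y<n
      ... | no  far =
        let z , x<z , z<y , gz = good-between x y (ℕ.≮⇒≥ far) (ℕ.<⇒≤ y<n)
        in Q-trans
          (within b gx gz x<z (ℕ.s≤s⁻¹ (ℕ.≤-trans z<y y≤b+x)) (ℕ.<-trans z<y y<n))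
          (within b gz gy z<y
            (ℕ.≤-trans y≤b+x (ℕ.≤-trans (ℕ.≤-reflexive (sym (ℕ.+-suc b x))) (ℕ.+-monoʳ-≤ b x<z)))
            y<n)

-- Gluing repairs under a local property.

≈-sym : ∀ {x y} → x ≈ y → y ≈ x
≈-sym (x≤y , y≤x) = y≤x , x≤y

≈-trans : ∀ {x y z} → x ≈ y → y ≈ z → x ≈ z
≈-trans (x≤y , y≤x) (y≤z , z≤y) = (λ q → y≤z q ∘ x≤y q) , (λ q → y≤x q ∘ z≤y q)

length-filter-tabulate : ∀ {P : Pred A s} (P? : Decidable P) {n} (h : Fin n → A) →
  length (filter P? (tabulate h)) ≡ sum (λ i → 𝟙 (P? (h i)))
length-filter-tabulate P? {zero}  h = refl
length-filter-tabulate P? {suc n} h with P? (h zero)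
... | yes _ = cong suc (length-filter-tabulate P? (h ∘ suc))
... | no  _ = length-filter-tabulate P? (h ∘ suc)

module Repair (em : Classical) {n : ℕ} {a : Level} {𝒫 : Pred (Sequence n) a}
  (local : IsLocal 𝒫) (f : Sequence n) where

  private
    F : Rel ℝ a
    F = proj₁ local

    F-resp : F Respects₂ _≈_
    F-resp = proj₁ (proj₂ local)

    allowed : ∀ g → 𝒫 g ⇔ (∀ (i j : Fin n) → toℕ j ≡ suc (toℕ i) → ¬ F (g i) (g j))
    allowed = proj₂ (proj₂ local)

  Repairable : Pred (Fin n) s → Set (lsuc 0ℓ ⊔ a ⊔ s)
  Repairable S = ∃[ g ] (∀ i → S i → g i ≈ f i) × 𝒫 g

  restrict : {S : Pred (Fin n) s} {T : Pred (Fin n) s′} → (∀ i → T i → S i) →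
    Repairable S → Repairable T
  restrict T⊆S (g , g≈f , g∈𝒫) = g , (λ i i∈T → g≈f i (T⊆S i i∈T)) , g∈𝒫

  -- Follow `g` up to `x` and `h` beyond it. The only consecutive pair that mixes the two starts at
  -- `x`, where both agree with `f`; since `F` respects `≈`, that pair is as allowed as it is in
  -- `h`.
  glue : {S : Pred (Fin n) s} {T : Pred (Fin n) s′} (x : ℕ) →
    (∀ i → S i → toℕ i ℕ.≤ x) → (∀ i → T i → x ℕ.≤ toℕ i) →
    (∀ i → toℕ i ≡ x → S i × T i) →
    Repairable S → Repairable T → Repairable (S ∪ T)
  glue {S = S} {T = T} x S≤x x≤T x∈S∩T (g , g≈f , g∈𝒫) (h , h≈f , h∈𝒫) =
    gh , gh≈f , Equivalence.from (allowed gh) gh-allowed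
    where
    gh : Sequence n
    gh i with toℕ i ℕ.≤? x
    ... | yes _ = g i
    ... | no  _ = h i

    gh≈f : ∀ i → (S ∪ T) i → gh i ≈ f i
    gh≈f i i∈ with toℕ i ℕ.≤? x | i∈
    ... | yes _   | inj₁ i∈S = g≈f i i∈S
    ... | yes i≤x | inj₂ i∈T = g≈f i (proj₁ (x∈S∩T i (ℕ.≤-antisym i≤x (x≤T i i∈T))))
    ... | no  i≰x | inj₁ i∈S = ⊥-elim (i≰x (S≤x i i∈S))
    ... | no  _   | inj₂ i∈T = h≈f i i∈T

    gh-allowed : ∀ (i j : Fin n) → toℕ j ≡ suc (toℕ i) → ¬ F (gh i) (gh j)
    gh-allowed i j j≡i+1 with toℕ i ℕ.≤? x | toℕ j ℕ.≤? x
    ... | yes _   | yes _   = Equivalence.to (allowed g) g∈𝒫 i j j≡i+1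
    ... | no  _   | no  _   = Equivalence.to (allowed h) h∈𝒫 i j j≡i+1
    ... | no  i≰x | yes j≤x = ⊥-elim (i≰x (ℕ.≤-trans (ℕ.n≤1+n _)
                                (subst (ℕ._≤ x) j≡i+1 j≤x)))
    ... | yes i≤x | no  j≰x = λ Fgh → Equivalence.to (allowed h) h∈𝒫 i j j≡i+1
      (proj₂ F-resp (≈-trans {g i} {f i} {h i} (g≈f i i∈S) (≈-sym {h i} {f i} (h≈f i i∈T))) Fgh)
      where
      i≡x : toℕ i ≡ x
      i≡x = ℕ.≤-antisym i≤x (ℕ.s≤s⁻¹ (subst (suc x ℕ.≤_) j≡i+1 (ℕ.≰⇒> j≰x)))

      i∈S : S i
      i∈S = proj₁ (x∈S∩T i i≡x)

      i∈T : T i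
      i∈T = proj₂ (x∈S∩T i i≡x)

  -- Positions are natural numbers rather than elements of `Fin n`, so that offsets can be added
  -- freely.
  Q : ℕ → ℕ → Set (lsuc 0ℓ ⊔ a)
  Q x y = x ℕ.< y × y ℕ.< n × Repairable (λ i → toℕ i ≡ x ⊎ toℕ i ≡ y)

  Q-trans : ∀ {x y z} → Q x y → Q y z → Q x z
  Q-trans {x} {y} {z} (x<y , y<n , r) (y<z , z<n , r′) =
    ℕ.<-trans x<y y<z , z<n ,
    restrict (λ { i (inj₁ i≡x) → inj₁ (inj₁ i≡x) ; i (inj₂ i≡z) → inj₂ (inj₂ i≡z) })
      (glue y (λ { i (inj₁ refl) → ℕ.<⇒≤ x<y ; i (inj₂ refl) → ℕ.≤-refl })
              (λ { i (inj₁ refl) → ℕ.≤-refl ; i (inj₂ refl) → ℕ.<⇒≤ y<z })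
              (λ i i≡y → inj₂ i≡y , inj₁ i≡y) r r′)

  module _ {Good : ℕ → Set}
    (Q-good : ∀ {x y} → Good x → Good y → x ℕ.< y → y ℕ.< n → Q x y)
    (good-repairable : ∀ {x} → Good x → x ℕ.< n → Repairable (λ i → toℕ i ≡ x))
    where

    -- The largest good point `x` is recorded because the next repair is glued on there.
    Chain : ℕ → Set (lsuc 0ℓ ⊔ a)
    Chain m = ∃[ x ] x ℕ.< m × Good x × (∀ y → y ℕ.< m → Good y → y ℕ.≤ x) ×
      Repairable (λ i → toℕ i ℕ.< m × Good (toℕ i))

    -- When `m` is good and `x` is the last good point before it, their link repairs both at once
    -- and is glued at `x` to the repair of all earlier good points. The first good point relies on
    -- `good-repairable`.
    chain : ∀ m → m ℕ.≤ n → (∀ x → x ℕ.< m → ¬ Good x) ⊎ Chain m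
    chain zero    _   = inj₁ λ _ ()
    chain (suc m) m<n with em {P = Good m} | chain m (ℕ.<⇒≤ m<n)
    ... | no ¬gm | inj₁ none = inj₁ λ x x<1+m gx →
      [ (λ x<m → none x x<m gx) , (λ { refl → ¬gm gx }) ]′ (ℕ.m<1+n⇒m<n∨m≡n x<1+m)
    ... | no ¬gm | inj₂ (x , x<m , gx , max , r) = inj₂
      (x , ℕ.m≤n⇒m≤1+n x<m , gx , (λ y y<1+m gy → max y (below y y<1+m gy) gy) ,
       restrict (λ i (i<1+m , gi) → below (toℕ i) i<1+m gi , gi) r)
      where
      below : ∀ y → y ℕ.< suc m → Good y → y ℕ.< m
      below y y<1+m gy with ℕ.m<1+n⇒m<n∨m≡n y<1+m
      ... | inj₁ y<m  = y<m
      ... | inj₂ refl = ⊥-elim (¬gm gy)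
    ... | yes gm | inj₁ none = inj₂
      (m , ℕ.≤-refl , gm , (λ y y<1+m _ → ℕ.s≤s⁻¹ y<1+m) ,
       restrict (λ i (i<1+m , gi) →
         [ (λ i<m → ⊥-elim (none (toℕ i) i<m gi)) , (λ i≡m → i≡m) ]′ (ℕ.m<1+n⇒m<n∨m≡n i<1+m))
         (good-repairable gm m<n))
    ... | yes gm | inj₂ (x , x<m , gx , max , r) = inj₂
      (m , ℕ.≤-refl , gm , (λ y y<1+m _ → ℕ.s≤s⁻¹ y<1+m) ,
       restrict (λ i (i<1+m , gi) →
         [ (λ i<m → inj₁ (i<m , gi)) , (λ i≡m → inj₂ (inj₂ i≡m)) ]′ (ℕ.m<1+n⇒m<n∨m≡n i<1+m))
         (glue x (λ i (i<m , gi) → max (toℕ i) i<m gi)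
                 (λ { i (inj₁ refl) → ℕ.≤-refl ; i (inj₂ refl) → ℕ.<⇒≤ x<m })
                 (λ { i refl → (x<m , gx) , inj₁ refl })
                 r (proj₂ (proj₂ (Q-good gx gm x<m m<n)))))

  -- Quantifying over both endpoints makes this false as soon as `u` or `2 ^ j + u` leaves the
  -- domain, as `v-out` requires.
  Rejected : ℕ → ℕ → Set (lsuc 0ℓ ⊔ a)
  Rejected j u = Σ[ x ∈ Fin n ] Σ[ y ∈ Fin n ]
    toℕ x ≡ u × toℕ y ≡ 2 ℕ.^ j + u × Unrepairable 𝒫 f (｛ x ｝ ∪ ｛ y ｝)

  v : ℕ → ℕ → ℕ
  v j u = 𝟙 (em {P = Rejected j u})

  v-out : ∀ j u → n ℕ.≤ u → v j u ≡ 0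
  v-out j u n≤u = 𝟙-no em λ (x , _ , x≡u , _) →
    ℕ.<⇒≱ (Fin.toℕ<n x) (ℕ.≤-trans n≤u (ℕ.≤-reflexive (sym x≡u)))

  v-edge : ∀ j u → v j u ≡ 0 → 2 ℕ.^ j + u ℕ.< n → Q u (2 ℕ.^ j + u)
  v-edge j u v≡0 y<n = u<y , y<n , repairable
    where
    u<y : u ℕ.< 2 ℕ.^ j + u
    u<y = ℕ.+-monoˡ-≤ u (ℕ.m^n>0 2 j)

    x y : Fin n
    x = fromℕ< (ℕ.<-trans u<y y<n)
    y = fromℕ< y<n

    x≡u : toℕ x ≡ u
    x≡u = Fin.toℕ-fromℕ< _

    y≡ : toℕ y ≡ 2 ℕ.^ j + u
    y≡ = Fin.toℕ-fromℕ< y<n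

    repairable : Repairable (λ i → toℕ i ≡ u ⊎ toℕ i ≡ 2 ℕ.^ j + u)
    repairable with em {P = Repairable (｛ x ｝ ∪ ｛ y ｝)}
    ... | yes r = restrict
      (λ { i (inj₁ i≡u) → inj₁ (Fin.toℕ-injective (trans x≡u (sym i≡u)))
         ; i (inj₂ i≡y) → inj₂ (Fin.toℕ-injective (trans y≡ (sym i≡y))) }) r
    ... | no ¬r = ⊥-elim (𝟙-≡0 em v≡0 (x , y , x≡u , y≡ , ¬r))

  open SpotCheck em {Q = Q} Q-trans n v v-out v-edge public

  -- Either all points are bad, and `#bad≤4N` bounds `n`, or the chain of good points gives one
  -- repair, which can differ from `f` only at bad points.
  repair-or-few : 2 ℕ.≤ n → ∀ ℓ → 4 * N (suc ℓ) ℕ.< 2 ℕ.^ suc ℓ →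
    n ℕ.≤ 4 * N (suc ℓ) ⊎ ∃[ g ] 𝒫 g × hamming em f g ℕ.≤ 4 * N (suc ℓ)
  repair-or-few 2≤n ℓ 4N<2ᴸ with chain {Good (suc ℓ)} (Q-good ℓ 4N<2ᴸ) single n ℕ.≤-refl
    where
    -- A good point is repairable through its link to a neighbour: the right one, or the left one at
    -- the end of the domain, which exists because `2 ≤ n`.
    single : ∀ {x} → Good (suc ℓ) x → x ℕ.< n → Repairable (λ i → toℕ i ≡ x)
    single {x} gx x<n with suc x ℕ.<? n
    ... | yes x+1<n = restrict (λ _ → inj₁)
      (proj₂ (proj₂ (Q-suc (suc ℓ) x (s≤s z≤n) gx x+1<n)))
    single {zero}  gx x<n | no 1≮n = ⊥-elim (1≮n 2≤n)
    single {suc x} gx x<n | no _   = restrict (λ _ → inj₂)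
      (proj₂ (proj₂ (Q-pred (suc ℓ) x (s≤s z≤n) gx x<n)))
  ... | inj₁ none = inj₁ (begin
    n                    ≡⟨ ℕ.*-identityʳ n ⟨
    n * 1                ≡⟨ sum-const n 1 ⟨
    Σ< n (λ _ → 1)       ≤⟨ Σ<-mono n (λ x x<n → ℕ.≤-reflexive
                              (sym (𝟙-yes (¬? (good? (suc ℓ) x)) (none x x<n)))) ⟩
    Σ< n (bad (suc ℓ))   ≤⟨ #bad≤4N (suc ℓ) ⟩
    4 * N (suc ℓ)        ∎)
    where open ℕ.≤-Reasoning
  ... | inj₂ (_ , _ , _ , _ , g , g≈f , g∈𝒫) = inj₂ (g , g∈𝒫 , (begin
    hamming em f g       ≡⟨ length-filter-tabulate (λ i → ¬? (em {P = f i ≈ g i})) (λ i → i) ⟩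
    sum (λ i → 𝟙 (¬? (em {P = f i ≈ g i}))) ≤⟨ sum-mono differ ⟩
    Σ< n (bad (suc ℓ))   ≤⟨ #bad≤4N (suc ℓ) ⟩
    4 * N (suc ℓ)        ∎))
    where
    open ℕ.≤-Reasoning

    differ : ∀ i → 𝟙 (¬? (em {P = f i ≈ g i})) ℕ.≤ bad (suc ℓ) (toℕ i)
    differ i with em {P = f i ≈ g i}
    ... | yes _   = z≤n
    ... | no  f≉g = ℕ.≤-reflexive (sym (𝟙-yes (¬? (good? (suc ℓ) (toℕ i)))
      λ gi → f≉g (≈-sym {g i} {f i} (g≈f i (Fin.toℕ<n i , gi)))))

-- Arithmetic of naturals inside the rationals.

ℕ⇒ℚ-+ : ∀ m n → ℕ⇒ℚ (m + n) ≡ ℕ⇒ℚ m ℚ.+ ℕ⇒ℚ n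
ℕ⇒ℚ-+ zero    n = sym (ℚ.+-identityˡ (ℕ⇒ℚ n))
ℕ⇒ℚ-+ (suc m) n = begin
  ℕ⇒ℚ (suc (m + n))              ≡⟨ ℕ⇒ℚ-suc (m + n) ⟩
  1ℚ ℚ.+ ℕ⇒ℚ (m + n)             ≡⟨ cong (1ℚ ℚ.+_) (ℕ⇒ℚ-+ m n) ⟩
  1ℚ ℚ.+ (ℕ⇒ℚ m ℚ.+ ℕ⇒ℚ n)       ≡⟨ ℚ.+-assoc 1ℚ (ℕ⇒ℚ m) (ℕ⇒ℚ n) ⟨
  1ℚ ℚ.+ ℕ⇒ℚ m ℚ.+ ℕ⇒ℚ n         ≡⟨ cong (ℚ._+ ℕ⇒ℚ n) (ℕ⇒ℚ-suc m) ⟨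
  ℕ⇒ℚ (suc m) ℚ.+ ℕ⇒ℚ n          ∎
  where open ≡-Reasoning

ℕ⇒ℚ-* : ∀ m n → ℕ⇒ℚ (m * n) ≡ ℕ⇒ℚ m ℚ.* ℕ⇒ℚ n
ℕ⇒ℚ-* zero    n = sym (ℚ.*-zeroˡ (ℕ⇒ℚ n))
ℕ⇒ℚ-* (suc m) n = begin
  ℕ⇒ℚ (n + m * n)                       ≡⟨ ℕ⇒ℚ-+ n (m * n) ⟩
  ℕ⇒ℚ n ℚ.+ ℕ⇒ℚ (m * n)                 ≡⟨ cong₂ ℚ._+_ (sym (ℚ.*-identityˡ (ℕ⇒ℚ n))) (ℕ⇒ℚ-* m n) ⟩
  1ℚ ℚ.* ℕ⇒ℚ n ℚ.+ ℕ⇒ℚ m ℚ.* ℕ⇒ℚ n      ≡⟨ ℚ.*-distribʳ-+ (ℕ⇒ℚ n) 1ℚ (ℕ⇒ℚ m) ⟨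
  (1ℚ ℚ.+ ℕ⇒ℚ m) ℚ.* ℕ⇒ℚ n              ≡⟨ cong (ℚ._* ℕ⇒ℚ n) (ℕ⇒ℚ-suc m) ⟨
  ℕ⇒ℚ (suc m) ℚ.* ℕ⇒ℚ n                 ∎
  where open ≡-Reasoning

ℕ⇒ℚ-mono-≤ : ∀ {m n} → m ℕ.≤ n → ℕ⇒ℚ m ℚ.≤ ℕ⇒ℚ n
ℕ⇒ℚ-mono-≤ {m} {n} m≤n = /≤ℕ (+ m) 1 n (ℤ.+≤+ (ℕ.≤-trans m≤n (ℕ.≤-reflexive (sym (ℕ.*-identityʳ n)))))

ℕ⇒ℚ-mono-< : ∀ {m n} → m ℕ.< n → ℕ⇒ℚ m ℚ.< ℕ⇒ℚ n
ℕ⇒ℚ-mono-< {m} m<n = ℚ.<-≤-trans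
  (subst (ℕ⇒ℚ m ℚ.<_) (trans (ℚ.+-comm (ℕ⇒ℚ m) 1ℚ) (sym (ℕ⇒ℚ-suc m))) (p<p+1 (ℕ⇒ℚ m)))
  (ℕ⇒ℚ-mono-≤ m<n)

ℕ⇒ℚ-cancel-< : ∀ {m n} → ℕ⇒ℚ m ℚ.< ℕ⇒ℚ n → m ℕ.< n
ℕ⇒ℚ-cancel-< m<n = ℕ.≰⇒> λ n≤m → ℚ.<-irrefl refl (ℚ.<-≤-trans m<n (ℕ⇒ℚ-mono-≤ n≤m))

ℕ⇒ℚ-nonNeg : ∀ n → ℚ.NonNegative (ℕ⇒ℚ n)
ℕ⇒ℚ-nonNeg n = ℚ.normalize-nonNeg n 1

ℕ⇒ℚ-pos : ∀ n → .{{ℕ.NonZero n}} → ℚ.Positive (ℕ⇒ℚ n)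
ℕ⇒ℚ-pos n = ℚ.normalize-pos n 1

-- Expectations and amplification by independent repetition.

𝔼 : Dist A → (A → ℚ) → ℚ
𝔼 []            h = 0ℚ
𝔼 ((x , p) ∷ μ) h = p ℚ.* h x ℚ.+ 𝔼 μ h

ι : Bool → ℚ
ι b = if b then 1ℚ else 0ℚ

*-ι : ∀ p b → p ℚ.* ι b ≡ (if b then p else 0ℚ)
*-ι p true  = ℚ.*-identityʳ p
*-ι p false = ℚ.*-zeroʳ p

Pr-𝔼 : ∀ (μ : Dist A) E → Pr μ E ≡ 𝔼 μ (ι ∘ E)
Pr-𝔼 []            E = refl
Pr-𝔼 ((x , p) ∷ μ) E = cong₂ ℚ._+_ (sym (*-ι p (E x))) (Pr-𝔼 μ E)

𝔼-cong : ∀ (μ : Dist A) {g h} → (∀ x → g x ≡ h x) → 𝔼 μ g ≡ 𝔼 μ h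
𝔼-cong []            g≗h = refl
𝔼-cong ((x , p) ∷ μ) g≗h = cong₂ ℚ._+_ (cong (p ℚ.*_) (g≗h x)) (𝔼-cong μ g≗h)

𝔼-++ : ∀ (μ ν : Dist A) h → 𝔼 (μ ++ ν) h ≡ 𝔼 μ h ℚ.+ 𝔼 ν h
𝔼-++ []            ν h = sym (ℚ.+-identityˡ (𝔼 ν h))
𝔼-++ ((x , p) ∷ μ) ν h = trans (cong (p ℚ.* h x ℚ.+_) (𝔼-++ μ ν h))
  (sym (ℚ.+-assoc (p ℚ.* h x) (𝔼 μ h) (𝔼 ν h)))

𝔼-scale : ∀ p (μ : Dist A) h →
  𝔼 (map (λ (y , q) → y , p ℚ.* q) μ) h ≡ p ℚ.* 𝔼 μ h
𝔼-scale p []            h = sym (ℚ.*-zeroʳ p)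
𝔼-scale p ((x , q) ∷ μ) h = trans
  (cong₂ ℚ._+_ (ℚ.*-assoc p q (h x)) (𝔼-scale p μ h))
  (sym (ℚ.*-distribˡ-+ p (q ℚ.* h x) (𝔼 μ h)))

𝔼->>= : ∀ (μ : Dist A) (κ : A → Dist B) h → 𝔼 (μ >>= κ) h ≡ 𝔼 μ (λ x → 𝔼 (κ x) h)
𝔼->>= []            κ h = refl
𝔼->>= ((x , p) ∷ μ) κ h = trans (𝔼-++ (map (λ (y , q) → y , p ℚ.* q) (κ x)) (μ >>= κ) h)
  (cong₂ ℚ._+_ (𝔼-scale p (κ x) h) (𝔼->>= μ κ h))

𝔼-return : ∀ (x : A) h → 𝔼 (return x) h ≡ h x
𝔼-return x h = trans (ℚ.+-identityʳ (1ℚ ℚ.* h x)) (ℚ.*-identityˡ (h x))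

𝔼-*ʳ : ∀ (μ : Dist A) h c → 𝔼 μ (λ x → h x ℚ.* c) ≡ 𝔼 μ h ℚ.* c
𝔼-*ʳ []            h c = sym (ℚ.*-zeroˡ c)
𝔼-*ʳ ((x , p) ∷ μ) h c = trans
  (cong₂ ℚ._+_ (sym (ℚ.*-assoc p (h x) c)) (𝔼-*ʳ μ h c))
  (sym (ℚ.*-distribʳ-+ c (p ℚ.* h x) (𝔼 μ h)))

𝔼-complement : ∀ (μ : Dist A) E →
  𝔼 μ (ι ∘ E) ℚ.+ 𝔼 μ (λ x → 1ℚ ℚ.- ι (E x)) ≡ 𝔼 μ (λ _ → 1ℚ)
𝔼-complement []            E = refl
𝔼-complement ((x , p) ∷ μ) E = trans
  (solve 4 (λ p i r s → (p :* i :+ r) :+ (p :* (con 1ℚ :- i) :+ s) := p :* con 1ℚ :+ (r :+ s))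
    refl p (ι (E x)) (𝔼 μ (ι ∘ E)) (𝔼 μ (λ x → 1ℚ ℚ.- ι (E x))))
  (cong (p ℚ.* 1ℚ ℚ.+_) (𝔼-complement μ E))
  where open +-*-Solver

module _ (μ : Dist A) (mass : 𝔼 μ (λ _ → 1ℚ) ≡ 1ℚ) (r : A → Bool) where

  any : ∀ {t} → Vec A t → Bool
  any c = Bool.any r (Vec.toList c)

  private
    p : ℚ
    p = Pr μ r

  miss : ℕ → ℚ
  miss t = 𝔼 (independent t μ) (λ c → 1ℚ ℚ.- ι (any c))

  independent-mass : ∀ t → 𝔼 (independent t μ) (λ _ → 1ℚ) ≡ 1ℚ
  independent-mass zero    = 𝔼-return {A = Vec A 0} [] (λ _ → 1ℚ)
  independent-mass (suc t) = begin
    𝔼 (independent (suc t) μ) (λ _ → 1ℚ)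
      ≡⟨ 𝔼->>= μ _ (λ _ → 1ℚ) ⟩
    𝔼 μ (λ x → 𝔼 (independent t μ >>= λ xs → return (x ∷ xs)) (λ _ → 1ℚ))
      ≡⟨ 𝔼-cong μ (λ x → 𝔼->>= (independent t μ) (λ xs → return (x ∷ xs)) (λ _ → 1ℚ)) ⟩
    𝔼 μ (λ x → 𝔼 (independent t μ) (λ xs → 1ℚ))
      ≡⟨ 𝔼-cong μ (λ _ → independent-mass t) ⟩
    𝔼 μ (λ x → 1ℚ)
      ≡⟨ mass ⟩
    1ℚ ∎
    where open ≡-Reasoning

  Pr-any : ∀ t → Pr (independent t μ) any ≡ 1ℚ ℚ.- miss t
  Pr-any t = begin
    Pr (independent t μ) any               ≡⟨ Pr-𝔼 (independent t μ) any ⟩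
    h                                      ≡⟨ solve 2 (λ h m → h := h :+ m :- m) refl h (miss t) ⟩
    h ℚ.+ miss t ℚ.- miss t                ≡⟨ cong (ℚ._- miss t) (𝔼-complement (independent t μ) any) ⟩
    𝔼 (independent t μ) (λ _ → 1ℚ) ℚ.- miss t ≡⟨ cong (ℚ._- miss t) (independent-mass t) ⟩
    1ℚ ℚ.- miss t                          ∎
    where
    open ≡-Reasoning
    open +-*-Solver

    h : ℚ
    h = 𝔼 (independent t μ) (ι ∘ any)

  -- The indicator of no hit is a product over the samples, and the first sample is independent of
  -- the others, so the expectation factors.
  miss-suc : ∀ t → miss (suc t) ≡ (1ℚ ℚ.- p) ℚ.* miss t
  miss-suc t = begin
    miss (suc t)
      ≡⟨ 𝔼->>= μ _ _ ⟩
    𝔼 μ (λ x → 𝔼 (independent t μ >>= λ xs → return (x ∷ xs)) (λ c → 1ℚ ℚ.- ι (any c)))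
      ≡⟨ 𝔼-cong μ (λ x → trans (𝔼->>= (independent t μ) (λ xs → return (x ∷ xs)) _)
           (trans (𝔼-cong (independent t μ) (λ xs → trans
             (𝔼-return (x ∷ xs) (λ c → 1ℚ ℚ.- ι (any c))) (first x xs)))
             (trans (𝔼-*ʳ (independent t μ) _ (1ℚ ℚ.- ι (r x)))
               (ℚ.*-comm (miss t) (1ℚ ℚ.- ι (r x)))))) ⟩
    𝔼 μ (λ x → (1ℚ ℚ.- ι (r x)) ℚ.* miss t)
      ≡⟨ 𝔼-*ʳ μ _ (miss t) ⟩
    𝔼 μ (λ x → 1ℚ ℚ.- ι (r x)) ℚ.* miss t
      ≡⟨ cong (ℚ._* miss t) complement ⟩
    (1ℚ ℚ.- p) ℚ.* miss t ∎
    where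
    open ≡-Reasoning
    open +-*-Solver

    first : ∀ x (xs : Vec A t) →
      1ℚ ℚ.- ι (any (x ∷ xs)) ≡ (1ℚ ℚ.- ι (any xs)) ℚ.* (1ℚ ℚ.- ι (r x))
    first x xs with r x
    ... | true  = sym (ℚ.*-zeroʳ (1ℚ ℚ.- ι (any xs)))
    ... | false = sym (ℚ.*-identityʳ (1ℚ ℚ.- ι (any xs)))

    q : ℚ
    q = 𝔼 μ (λ x → 1ℚ ℚ.- ι (r x))

    complement : q ≡ 1ℚ ℚ.- p
    complement = begin
      q                          ≡⟨ solve 2 (λ p q → q := p :+ q :- p) refl (𝔼 μ (ι ∘ r)) q ⟩
      𝔼 μ (ι ∘ r) ℚ.+ q ℚ.- 𝔼 μ (ι ∘ r) ≡⟨ cong₂ ℚ._-_ (trans (𝔼-complement μ r) mass) (sym (Pr-𝔼 μ r)) ⟩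
      1ℚ ℚ.- p                   ∎

  module _ (0≤p : 0ℚ ℚ.≤ p) (p≤1 : p ℚ.≤ 1ℚ) where

    private
      instance
        1-p≥0 : ℚ.NonNegative (1ℚ ℚ.- p)
        1-p≥0 = ℚ.nonNegative (subst (ℚ._≤ 1ℚ ℚ.- p) (ℚ.+-inverseʳ p) (ℚ.+-monoˡ-≤ (ℚ.- p) p≤1))

        p≥0 : ℚ.NonNegative p
        p≥0 = ℚ.nonNegative 0≤p

    miss≥0 : ∀ t → ℚ.NonNegative (miss t)
    miss≥0 zero    = subst ℚ.NonNegative (sym (𝔼-return {A = Vec A 0} [] (λ c → 1ℚ ℚ.- ι (any c)))) _
    miss≥0 (suc t) = subst ℚ.NonNegative (sym (miss-suc t))
      (ℚ.nonNeg*nonNeg⇒nonNeg (1ℚ ℚ.- p) (miss t) {{miss≥0 t}})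

    -- Bernoulli's inequality, as miss t = (1 - p)ᵗ.

    miss-bernoulli : ∀ t → miss t ℚ.* (1ℚ ℚ.+ ℕ⇒ℚ t ℚ.* p) ℚ.≤ 1ℚ
    miss-bernoulli zero    = ℚ.≤-reflexive (trans
      (cong₂ ℚ._*_ (𝔼-return {A = Vec A 0} [] (λ c → 1ℚ ℚ.- ι (any c)))
                   (cong (1ℚ ℚ.+_) (ℚ.*-zeroˡ p))) refl)
    miss-bernoulli (suc t) = begin
      miss (suc t) ℚ.* (1ℚ ℚ.+ ℕ⇒ℚ (suc t) ℚ.* p)
        ≡⟨ cong₂ (λ m k → m ℚ.* (1ℚ ℚ.+ k ℚ.* p)) (miss-suc t) (ℕ⇒ℚ-suc t) ⟩
      (1ℚ ℚ.- p) ℚ.* miss t ℚ.* (1ℚ ℚ.+ (1ℚ ℚ.+ ℕ⇒ℚ t) ℚ.* p)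
        ≡⟨ solve 3 (λ p m k →
             (con 1ℚ :- p) :* m :* (con 1ℚ :+ (con 1ℚ :+ k) :* p) :=
             m :* (con 1ℚ :+ k :* p) :- m :* ((con 1ℚ :+ k) :* (p :* p)))
             refl p (miss t) (ℕ⇒ℚ t) ⟩
      miss t ℚ.* (1ℚ ℚ.+ ℕ⇒ℚ t ℚ.* p) ℚ.- loss
        ≤⟨ ℚ.+-monoʳ-≤ (miss t ℚ.* (1ℚ ℚ.+ ℕ⇒ℚ t ℚ.* p))
             (ℚ.neg-antimono-≤ (ℚ.nonNegative⁻¹ loss {{loss≥0}})) ⟩
      miss t ℚ.* (1ℚ ℚ.+ ℕ⇒ℚ t ℚ.* p) ℚ.+ 0ℚ
        ≡⟨ ℚ.+-identityʳ _ ⟩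
      miss t ℚ.* (1ℚ ℚ.+ ℕ⇒ℚ t ℚ.* p)
        ≤⟨ miss-bernoulli t ⟩
      1ℚ ∎
      where
      open ℚ.≤-Reasoning
      open +-*-Solver

      loss : ℚ
      loss = miss t ℚ.* ((1ℚ ℚ.+ ℕ⇒ℚ t) ℚ.* (p ℚ.* p))

      loss≥0 : ℚ.NonNegative loss
      loss≥0 = ℚ.nonNeg*nonNeg⇒nonNeg (miss t) {{miss≥0 t}} ((1ℚ ℚ.+ ℕ⇒ℚ t) ℚ.* (p ℚ.* p))
        {{ℚ.nonNeg*nonNeg⇒nonNeg (1ℚ ℚ.+ ℕ⇒ℚ t)
            {{subst ℚ.NonNegative (ℕ⇒ℚ-suc t) (ℕ⇒ℚ-nonNeg (suc t))}}
            (p ℚ.* p) {{ℚ.nonNeg*nonNeg⇒nonNeg p p}}}}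

    -- Six expected hits suffice: `miss-bernoulli` then gives `miss t * 7 ≤ 1`.
    amplify : ∀ t → ℕ⇒ℚ 6 ℚ.≤ ℕ⇒ℚ t ℚ.* p →
      1ℚ ℚ.- (+ 1 ℚ./ 7) ℚ.≤ Pr (independent t μ) any
    amplify t 6≤tp = subst (1ℚ ℚ.- (+ 1 ℚ./ 7) ℚ.≤_) (sym (Pr-any t))
      (ℚ.+-monoʳ-≤ 1ℚ (ℚ.neg-antimono-≤ miss≤1/7))
      where
      open ℚ.≤-Reasoning

      miss≤1/7 : miss t ℚ.≤ + 1 ℚ./ 7
      miss≤1/7 = ℚ.*-cancelʳ-≤-pos (ℕ⇒ℚ 7) (begin
        miss t ℚ.* ℕ⇒ℚ 7
          ≤⟨ ℚ.*-monoˡ-≤-nonNeg (miss t) {{miss≥0 t}} (ℚ.+-monoʳ-≤ 1ℚ 6≤tp) ⟩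
        miss t ℚ.* (1ℚ ℚ.+ ℕ⇒ℚ t ℚ.* p)
          ≤⟨ miss-bernoulli t ⟩
        (+ 1 ℚ./ 7) ℚ.* ℕ⇒ℚ 7 ∎)

-- Counting the pairs that one iteration can sample.

lsum : (A → ℕ) → List A → ℕ
lsum g []       = 0
lsum g (x ∷ xs) = g x + lsum g xs

lsum-1 : (xs : List A) → lsum (λ _ → 1) xs ≡ length xs
lsum-1 []       = refl
lsum-1 (_ ∷ xs) = cong suc (lsum-1 xs)

lsum-++ : ∀ g (xs ys : List A) → lsum g (xs ++ ys) ≡ lsum g xs + lsum g ys
lsum-++ g []       ys = refl
lsum-++ g (x ∷ xs) ys = trans (cong (g x ℕ.+_) (lsum-++ g xs ys))
  (sym (ℕ.+-assoc (g x) (lsum g xs) (lsum g ys)))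

lsum-map : ∀ g (h : A → B) xs → lsum g (map h xs) ≡ lsum (g ∘ h) xs
lsum-map g h []       = refl
lsum-map g h (x ∷ xs) = cong (g (h x) ℕ.+_) (lsum-map g h xs)

lsum-filter : ∀ {P : Pred A s} (P? : Decidable P) g xs →
  lsum g (filter P? xs) ≡ lsum (λ x → 𝟙 (P? x) * g x) xs
lsum-filter P? g []       = refl
lsum-filter P? g (x ∷ xs) with P? x
... | yes _ = cong₂ _+_ (sym (ℕ.*-identityˡ (g x))) (lsum-filter P? g xs)
... | no  _ = lsum-filter P? g xs

lsum-tabulate : ∀ g {n} (h : Fin n → A) → lsum g (tabulate h) ≡ sum (g ∘ h)
lsum-tabulate g {zero}  h = refl
lsum-tabulate g {suc n} h = cong (g (h zero) ℕ.+_) (lsum-tabulate g (h ∘ suc))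

lsum-cartesianProduct : ∀ g {n} (h : Fin n → A) (ys : List B) →
  lsum g (cartesianProduct (tabulate h) ys) ≡ sum (λ i → lsum (λ y → g (h i , y)) ys)
lsum-cartesianProduct g {zero}  h ys = refl
lsum-cartesianProduct g {suc n} h ys = trans
  (lsum-++ g (map (h zero ,_) ys) (cartesianProduct (tabulate (h ∘ suc)) ys))
  (cong₂ _+_ (lsum-map g (h zero ,_) ys) (lsum-cartesianProduct g (h ∘ suc) ys))

lsum-applyUpTo : ∀ g (h : ℕ → A) n → lsum g (applyUpTo h n) ≡ Σ< n (g ∘ h)
lsum-applyUpTo g h zero    = refl
lsum-applyUpTo g h (suc n) = cong (g (h 0) ℕ.+_) (lsum-applyUpTo g (h ∘ suc) n)

-- Expectations become counts once denominators are cleared. The factor `k` is the denominator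
-- already present in `h`, so that the lemma can be applied to nested uniform choices.
uniform-𝔼 : ∀ k (c : A → ℕ) (h : A → ℚ) → (∀ x → ℕ⇒ℚ k ℚ.* h x ≡ ℕ⇒ℚ (c x)) →
  ∀ xs → ℕ⇒ℚ (length xs * k) ℚ.* 𝔼 (uniform xs) h ≡ ℕ⇒ℚ (lsum c xs)
uniform-𝔼 k c h kh≡c []          = ℚ.*-zeroʳ (ℕ⇒ℚ 0)
uniform-𝔼 {A = A} k c h kh≡c xs@(_ ∷ xs′) = begin
  ℕ⇒ℚ (l * k) ℚ.* 𝔼 (uniform xs) h    ≡⟨ cong (ℚ._* 𝔼 (uniform xs) h) (ℕ⇒ℚ-* l k) ⟩
  ℕ⇒ℚ l ℚ.* ℕ⇒ℚ k ℚ.* 𝔼 (uniform xs) h ≡⟨ ℚ.*-assoc (ℕ⇒ℚ l) (ℕ⇒ℚ k) _ ⟩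
  ℕ⇒ℚ l ℚ.* (ℕ⇒ℚ k ℚ.* 𝔼 (uniform xs) h) ≡⟨ cong (ℕ⇒ℚ l ℚ.*_) (weighted xs) ⟩
  ℕ⇒ℚ l ℚ.* (w ℚ.* ℕ⇒ℚ (lsum c xs))    ≡⟨ ℚ.*-assoc (ℕ⇒ℚ l) w _ ⟨
  ℕ⇒ℚ l ℚ.* w ℚ.* ℕ⇒ℚ (lsum c xs)      ≡⟨ cong (ℚ._* ℕ⇒ℚ (lsum c xs)) lw≡1 ⟩
  1ℚ ℚ.* ℕ⇒ℚ (lsum c xs)               ≡⟨ ℚ.*-identityˡ _ ⟩
  ℕ⇒ℚ (lsum c xs)                      ∎
  where
  open ≡-Reasoning
  open +-*-Solver

  l : ℕ
  l = length xs

  w : ℚ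
  w = + 1 ℚ./ l

  lw≡1 : ℕ⇒ℚ l ℚ.* w ≡ 1ℚ
  lw≡1 = ℚ.toℚᵘ-injective (ℚᵘ.≃-trans (ℚ.toℚᵘ-homo-* (ℕ⇒ℚ l) w)
    (ℚᵘ.≃-trans (ℚᵘ.*-cong (ℚ.toℚᵘ-fromℚᵘ (mkℚᵘ (+ l) 0)) (ℚ.toℚᵘ-fromℚᵘ (mkℚᵘ (+ 1) (length xs′))))
      (*≡* (cong +_ (trans (ℕ.*-identityʳ (l * 1))
        (trans (ℕ.*-comm l 1) (cong (1 *_) (sym (ℕ.*-identityˡ l)))))))))

  weighted : (ys : List A) → ℕ⇒ℚ k ℚ.* 𝔼 (map (λ x → x , w) ys) h ≡ w ℚ.* ℕ⇒ℚ (lsum c ys)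
  weighted []       = trans (ℚ.*-zeroʳ (ℕ⇒ℚ k)) (sym (ℚ.*-zeroʳ w))
  weighted (y ∷ ys) = begin
    ℕ⇒ℚ k ℚ.* (w ℚ.* h y ℚ.+ e)
      ≡⟨ solve 4 (λ k w h e → k :* (w :* h :+ e) := w :* (k :* h) :+ k :* e) refl (ℕ⇒ℚ k) w (h y) e ⟩
    w ℚ.* (ℕ⇒ℚ k ℚ.* h y) ℚ.+ ℕ⇒ℚ k ℚ.* e
      ≡⟨ cong₂ (λ a b → w ℚ.* a ℚ.+ b) (kh≡c y) (weighted ys) ⟩
    w ℚ.* ℕ⇒ℚ (c y) ℚ.+ w ℚ.* ℕ⇒ℚ (lsum c ys)
      ≡⟨ ℚ.*-distribˡ-+ w _ _ ⟨
    w ℚ.* (ℕ⇒ℚ (c y) ℚ.+ ℕ⇒ℚ (lsum c ys))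
      ≡⟨ cong (w ℚ.*_) (ℕ⇒ℚ-+ (c y) (lsum c ys)) ⟨
    w ℚ.* ℕ⇒ℚ (lsum c (y ∷ ys)) ∎
    where
    e : ℚ
    e = 𝔼 (map (λ x → x , w) ys) h

sum-unique : (g : Fin (suc m) → ℕ) (i : Fin (suc m)) → g i ≡ 1 → (∀ j → j ≢ i → g j ≡ 0) → sum g ≡ 1
sum-unique {m} g i gi≡1 g≡0 = begin
  sum g                                ≡⟨ sum-remove {i = i} g ⟩
  g i + sum (λ j → g (Fin.punchIn i j)) ≡⟨ cong₂ _+_ gi≡1 (trans
      (sum-cong-≗ (λ j → g≡0 (Fin.punchIn i j) (Fin.punchInᵢ≢i i j))) (trans (sum-const m 0) (ℕ.*-zeroʳ m))) ⟩
  1                                    ∎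
  where open ≡-Reasoning

Congruent : ∀ (d n : ℕ) (x y : Fin n) → Set
Congruent d n x y = + n ∣ (+ toℕ y ℤ.- + toℕ x) ℤ.- + d

congruent? : ∀ d n x y → Dec (Congruent d n x y)
congruent? d n x y = + n ∣? (+ toℕ y ℤ.- + toℕ x) ℤ.- + d

lsum-D : ∀ d n g →
  lsum g (D d n) ≡ sum {n} (λ x → sum {n} (λ y → 𝟙 (congruent? d n x y) * g (x , y)))
lsum-D d n g = begin
  lsum g (D d n)                         ≡⟨ lsum-filter (λ (x , y) → congruent? d n x y) g pairs ⟩
  lsum k pairs                           ≡⟨ lsum-cartesianProduct k id (allFin n) ⟩
  sum (λ x → lsum (λ y → k (x , y)) (allFin n))
    ≡⟨ sum-cong-≗ {n} (λ x → lsum-tabulate (λ y → k (x , y)) id) ⟩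
  sum {n} (λ x → sum {n} (λ y → k (x , y))) ∎
  where
  open ≡-Reasoning

  pairs : List (Fin n × Fin n)
  pairs = cartesianProduct (allFin n) (allFin n)

  k : Fin n × Fin n → ℕ
  k (x , y) = 𝟙 (congruent? d n x y) * g (x , y)

-- Every `x` has exactly one partner, the residue of `x + d` modulo `n`.
length-D : ∀ d n → length (D d n) ≡ n
length-D d zero    = refl
length-D d n@(suc _) = begin
  length (D d n)              ≡⟨ lsum-1 (D d n) ⟨
  lsum (λ _ → 1) (D d n)      ≡⟨ lsum-D d n (λ _ → 1) ⟩
  sum {n} (λ x → sum {n} (λ y → 𝟙 (congruent? d n x y) * 1))
    ≡⟨ sum-cong-≗ {n} (λ x → sum-unique (λ y → 𝟙 (congruent? d n x y) * 1) (shift x)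
         (trans (ℕ.*-identityʳ _) (𝟙-yes (congruent? d n x (shift x)) (shift-congruent x)))
         (λ y y≢ → trans (ℕ.*-identityʳ _) (𝟙-no (congruent? d n x y)
           (λ c → y≢ (unique x y c))))) ⟩
  sum {n} (λ _ → 1)           ≡⟨ sum-const n 1 ⟩
  n * 1                       ≡⟨ ℕ.*-identityʳ n ⟩
  n                           ∎
  where
  open ≡-Reasoning

  shift : Fin n → Fin n
  shift x = fromℕ< (ℕ.m%n<n (toℕ x + d) n)

  shift-congruent : ∀ x → Congruent d n x (shift x)
  shift-congruent x = divides (ℤ.- (+ q)) (begin
    (+ toℕ (shift x) ℤ.- + toℕ x) ℤ.- + d    ≡⟨ cong (λ r → (+ r ℤ.- + toℕ x) ℤ.- + d) (Fin.toℕ-fromℕ< _) ⟩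
    (+ r ℤ.- + toℕ x) ℤ.- + d                ≡⟨ regroup (+ r) (+ toℕ x) (+ d) ⟩
    + r ℤ.- (+ toℕ x ℤ.+ + d)                ≡⟨ cong (λ s → + r ℤ.- s) x+d ⟩
    + r ℤ.- (+ r ℤ.+ + q ℤ.* + n)            ≡⟨ cancel (+ r) (+ q) (+ n) ⟩
    ℤ.- (+ q) ℤ.* + n                        ∎)
    where
    q r : ℕ
    q = (toℕ x + d) ℕ./ n
    r = (toℕ x + d) ℕ.% n

    x+d : + toℕ x ℤ.+ + d ≡ + r ℤ.+ + q ℤ.* + n
    x+d = trans (cong +_ (ℕ.m≡m%n+[m/n]*n (toℕ x + d) n)) (cong (λ s → + r ℤ.+ s) (ℤ.pos-* q n))

    regroup : ∀ r x d → (r ℤ.- x) ℤ.- d ≡ r ℤ.- (x ℤ.+ d)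
    regroup = ℤSolver.solve-∀

    cancel : ∀ r q n → r ℤ.- (r ℤ.+ q ℤ.* n) ≡ ℤ.- q ℤ.* n
    cancel = ℤSolver.solve-∀

  -- `y` and `shift x` are congruent modulo `n` and less than `n` apart.
  unique : ∀ x y → Congruent d n x y → y ≡ shift x
  unique x y c = Fin.toℕ-injective (ℤ.+-injective (ℤ.i-j≡0⇒i≡j _ _ (ℤ.∣i∣≡0⇒i≡0 distance≡0)))
    where
    z : Fin n
    z = shift x

    cancel : ∀ y z x d → ((y ℤ.- x) ℤ.- d) ℤ.- ((z ℤ.- x) ℤ.- d) ≡ y ℤ.- z
    cancel = ℤSolver.solve-∀

    n∣distance : n ℕ.∣ ℤ.∣ + toℕ y ℤ.- + toℕ z ∣
    n∣distance = ∣⇒∣ᵤ (subst (+ n ∣_) (cancel (+ toℕ y) (+ toℕ z) (+ toℕ x) (+ d))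
      (∣m∣n⇒∣m-n c (shift-congruent x)))

    distance<n : ℤ.∣ + toℕ y ℤ.- + toℕ z ∣ ℕ.< n
    distance<n = ℕ.≤-<-trans
      (subst (λ i → ℤ.∣ i ∣ ℕ.≤ toℕ y ℕ.⊔ toℕ z) (sym (ℤ.m-n≡m⊖n (toℕ y) (toℕ z)))
        (ℤ.∣m⊝n∣≤m⊔n (toℕ y) (toℕ z)))
      (ℕ.⊔-lub (Fin.toℕ<n y) (Fin.toℕ<n z))

    distance≡0 : ℤ.∣ + toℕ y ℤ.- + toℕ z ∣ ≡ 0
    distance≡0 with ℤ.∣ + toℕ y ℤ.- + toℕ z ∣ | n∣distance | distance<n
    ... | zero  | _   | _   = refl
    ... | suc k | n∣k | k<n = ⊥-elim (ℕ.<⇒≱ k<n (ℕ.∣⇒≤ n∣k))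

lsum≤length : ∀ {g : A → ℕ} → (∀ x → g x ℕ.≤ 1) → ∀ xs → lsum g xs ℕ.≤ length xs
lsum≤length g≤1 []       = z≤n
lsum≤length g≤1 (x ∷ xs) = ℕ.+-mono-≤ (g≤1 x) (lsum≤length g≤1 xs)

bit : Bool → ℕ
bit b = if b then 1 else 0

bit≤1 : ∀ b → bit b ℕ.≤ 1
bit≤1 true  = s≤s z≤n
bit≤1 false = z≤n

ι-bit : ∀ b → ℕ⇒ℚ 1 ℚ.* ι b ≡ ℕ⇒ℚ (bit b)
ι-bit true  = refl
ι-bit false = refl

*-cancelˡ-≡-pos : ∀ r .{{_ : ℚ.Positive r}} {p q} → r ℚ.* p ≡ r ℚ.* q → p ≡ q
*-cancelˡ-≡-pos r rp≡rq = ℚ.≤-antisym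
  (ℚ.*-cancelˡ-≤-pos r (ℚ.≤-reflexive rp≡rq))
  (ℚ.*-cancelˡ-≤-pos r (ℚ.≤-reflexive (sym rp≡rq)))

module Sampling (L n : ℕ) .{{_ : ℕ.NonZero L}} .{{_ : ℕ.NonZero n}} where

  sample : Dist (Fin n × Fin n)
  sample = uniform (upTo L) >>= λ i → uniform (D (2 ℕ.^ i) n)

  hits : (Fin n × Fin n → Bool) → ℕ → ℕ
  hits E i = lsum (bit ∘ E) (D (2 ℕ.^ i) n)

  -- There are `L` scales, and every `D (2 ^ i) n` has the same length `n`, so all `L * n` outcomes
  -- carry equal weight.
  sample-hits : ∀ E → ℕ⇒ℚ (L * n) ℚ.* 𝔼 sample (ι ∘ E) ≡ ℕ⇒ℚ (Σ< L (hits E))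
  sample-hits E = begin
    ℕ⇒ℚ (L * n) ℚ.* 𝔼 sample (ι ∘ E)
      ≡⟨ cong₂ (λ l e → ℕ⇒ℚ (l * n) ℚ.* e) (sym (List.length-upTo L))
           (𝔼->>= (uniform (upTo L)) (λ i → uniform (D (2 ℕ.^ i) n)) (ι ∘ E)) ⟩
    ℕ⇒ℚ (length (upTo L) * n) ℚ.* 𝔼 (uniform (upTo L)) scale
      ≡⟨ uniform-𝔼 n (hits E) scale scale-hits (upTo L) ⟩
    ℕ⇒ℚ (lsum (hits E) (upTo L))
      ≡⟨ cong ℕ⇒ℚ (lsum-applyUpTo (hits E) id L) ⟩
    ℕ⇒ℚ (Σ< L (hits E)) ∎
    where
    open ≡-Reasoning

    scale : ℕ → ℚ
    scale i = 𝔼 (uniform (D (2 ℕ.^ i) n)) (ι ∘ E)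

    scale-hits : ∀ i → ℕ⇒ℚ n ℚ.* scale i ≡ ℕ⇒ℚ (hits E i)
    scale-hits i = trans
      (cong (λ l → ℕ⇒ℚ l ℚ.* scale i)
        (sym (trans (ℕ.*-identityʳ (length (D (2 ℕ.^ i) n))) (length-D (2 ℕ.^ i) n))))
      (uniform-𝔼 1 (bit ∘ E) (ι ∘ E) (ι-bit ∘ E) (D (2 ℕ.^ i) n))

  private
    instance
      Ln≢0 : ℕ.NonZero (L * n)
      Ln≢0 = ℕ.m*n≢0 L n

      Ln>0 : ℚ.Positive (ℕ⇒ℚ (L * n))
      Ln>0 = ℕ⇒ℚ-pos (L * n)

  sample-mass : 𝔼 sample (λ _ → 1ℚ) ≡ 1ℚ
  sample-mass = *-cancelˡ-≡-pos (ℕ⇒ℚ (L * n)) (begin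
    ℕ⇒ℚ (L * n) ℚ.* 𝔼 sample (λ _ → 1ℚ)  ≡⟨ sample-hits (λ _ → true) ⟩
    ℕ⇒ℚ (Σ< L (hits (λ _ → true)))      ≡⟨ cong ℕ⇒ℚ (trans (sum-cong-≗ {L} (λ i →
                                             trans (lsum-1 (D (2 ℕ.^ toℕ i) n)) (length-D (2 ℕ.^ toℕ i) n)))
                                             (sum-const L n)) ⟩
    ℕ⇒ℚ (L * n)                          ≡⟨ ℚ.*-identityʳ (ℕ⇒ℚ (L * n)) ⟨
    ℕ⇒ℚ (L * n) ℚ.* 1ℚ                   ∎)
    where open ≡-Reasoning

  -- The hypothesis is `6 ≤ t * p` for the hit probability `p`, with the denominator `L * n`
  -- cleared.
  sample-amplify : ∀ E t → 6 * (L * n) ℕ.≤ t * Σ< L (hits E) →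
    1ℚ ℚ.- (+ 1 ℚ./ 7) ℚ.≤ Pr (independent t sample) (λ c → Bool.any E (Vec.toList c))
  sample-amplify E t 6Ln≤tK = amplify sample sample-mass E 0≤p p≤1 t 6≤tp
    where
    open ℚ.≤-Reasoning

    M p : ℚ
    M = ℕ⇒ℚ (L * n)
    p = Pr sample E

    K : ℕ
    K = Σ< L (hits E)

    Mp≡K : M ℚ.* p ≡ ℕ⇒ℚ K
    Mp≡K = trans (cong (M ℚ.*_) (Pr-𝔼 sample E)) (sample-hits E)

    0≤p : 0ℚ ℚ.≤ p
    0≤p = ℚ.*-cancelˡ-≤-pos M (begin
      M ℚ.* 0ℚ  ≡⟨ ℚ.*-zeroʳ M ⟩
      0ℚ        ≤⟨ ℕ⇒ℚ-mono-≤ {0} {K} z≤n ⟩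
      ℕ⇒ℚ K     ≡⟨ Mp≡K ⟨
      M ℚ.* p   ∎)

    K≤Ln : K ℕ.≤ L * n
    K≤Ln = ℕ.≤-trans (Σ<-mono L (λ i _ → ℕ.≤-trans
      (lsum≤length (bit≤1 ∘ E) (D (2 ℕ.^ i) n)) (ℕ.≤-reflexive (length-D (2 ℕ.^ i) n))))
      (ℕ.≤-reflexive (sum-const L n))

    p≤1 : p ℚ.≤ 1ℚ
    p≤1 = ℚ.*-cancelˡ-≤-pos M (begin
      M ℚ.* p   ≡⟨ Mp≡K ⟩
      ℕ⇒ℚ K     ≤⟨ ℕ⇒ℚ-mono-≤ K≤Ln ⟩
      M         ≡⟨ ℚ.*-identityʳ M ⟨
      M ℚ.* 1ℚ  ∎)

    6≤tp : ℕ⇒ℚ 6 ℚ.≤ ℕ⇒ℚ t ℚ.* p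
    6≤tp = ℚ.*-cancelˡ-≤-pos M (begin
      M ℚ.* ℕ⇒ℚ 6            ≡⟨ ℚ.*-comm M (ℕ⇒ℚ 6) ⟩
      ℕ⇒ℚ 6 ℚ.* M            ≡⟨ ℕ⇒ℚ-* 6 (L * n) ⟨
      ℕ⇒ℚ (6 * (L * n))      ≤⟨ ℕ⇒ℚ-mono-≤ 6Ln≤tK ⟩
      ℕ⇒ℚ (t * K)            ≡⟨ ℕ⇒ℚ-* t K ⟩
      ℕ⇒ℚ t ℚ.* ℕ⇒ℚ K        ≡⟨ cong (ℕ⇒ℚ t ℚ.*_) Mp≡K ⟨
      ℕ⇒ℚ t ℚ.* (M ℚ.* p)    ≡⟨ solve 3 (λ t m p → t :* (m :* p) := m :* (t :* p)) refl (ℕ⇒ℚ t) M p ⟩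
      M ℚ.* (ℕ⇒ℚ t ℚ.* p)    ∎)
      where open +-*-Solver

-- Reals: comparison, floor, ceiling and logarithm.

≤-trans : ∀ {x y z} → x ≤ y → y ≤ z → x ≤ z
≤-trans x≤y y≤z q = y≤z q ∘ x≤y q

fromℕ-mono : ∀ {m n} → m ℕ.≤ n → fromℕ m ≤ fromℕ n
fromℕ-mono m≤n q q<m = ℚ.<-≤-trans q<m (ℕ⇒ℚ-mono-≤ m≤n)

n·ε≤n : ∀ n {ε} → ε < fromℕ 1 → n · ε ≤ fromℕ n
n·ε≤n n {ε} (q , q≮ε , q<1) r (s , s<ε , r<ns) = ℚ.<-≤-trans r<ns (begin
  ℕ⇒ℚ n ℚ.* s   ≤⟨ ℚ.*-monoˡ-≤-nonNeg (ℕ⇒ℚ n) {{ℕ⇒ℚ-nonNeg n}}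
                     (ℚ.≤-trans (lower≤upper ε s<ε q≮ε) (ℚ.<⇒≤ q<1)) ⟩
  ℕ⇒ℚ n ℚ.* 1ℚ  ≡⟨ ℚ.*-identityʳ (ℕ⇒ℚ n) ⟩
  ℕ⇒ℚ n         ∎)
  where open ℚ.≤-Reasoning

4≤n·ε⇒2<n : ∀ {n ε} → ε < fromℕ 1 → fromℕ 4 ≤ n · ε → 2 ℕ.< n
4≤n·ε⇒2<n {n} {ε} ε<1 4≤nε = ℕ⇒ℚ-cancel-< (n·ε≤n n {ε} ε<1 2ℚ
  (4≤nε 2ℚ (ℕ⇒ℚ-mono-< {2} {4} (s≤s (s≤s (s≤s z≤n))))))

ℕ⇒ℚ-2^ : ∀ k → ℕ⇒ℚ (2 ℕ.^ k) ≡ 2ℚ ^ k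
ℕ⇒ℚ-2^ zero    = refl
ℕ⇒ℚ-2^ (suc k) = trans (ℕ⇒ℚ-* 2 (2 ℕ.^ k)) (cong (2ℚ ℚ.*_) (ℕ⇒ℚ-2^ k))

module _ (em : Classical) where

  ≤-⌈⌉ : ∀ x {k} → ⌈ x ⌉ em ≡ k → x ≤ fromℕ k
  ≤-⌈⌉ x refl = let N , x≤N = natural-bound x in
    proj₁ (proj₂ (least em {λ k → x ≤ fromℕ k} N (λ _ → x≤N)))

  ⌊⌋-spec : ∀ x → x < fromℕ (suc (⌊ x ⌋ em)) × (∀ {j} → x < fromℕ (suc j) → ⌊ x ⌋ em ℕ.≤ j)
  ⌊⌋-spec x = let N , x≤N = natural-bound x in
    proj₂ (least em {λ k → x < fromℕ (suc k)} N
      ( ℕ⇒ℚ N , (λ N<x → ℚ.<-irrefl refl (x≤N N<x))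
      , subst (ℕ⇒ℚ N ℚ.<_) (trans (ℚ.+-comm (ℕ⇒ℚ N) 1ℚ) (sym (ℕ⇒ℚ-suc N)))
          (p<p+1 (ℕ⇒ℚ N)) ))

  <-⌊⌋ : ∀ x {k} → ⌊ x ⌋ em ≡ k → x < fromℕ (suc k)
  <-⌊⌋ x refl = proj₁ (⌊⌋-spec x)

  -- Otherwise `q` would witness `x < fromℕ (suc k)`, and minimality would make the floor at most
  -- `k`. A floor of 0 may come from the cut-off and gives no lower bound, hence the successor.
  below-⌊⌋ : ∀ x {k} → ⌊ x ⌋ em ≡ suc k → ∀ {q} → q ℚ.< ℕ⇒ℚ (suc k) → lower x q
  below-⌊⌋ x {k} ⌊x⌋≡1+k {q} q<1+k = decidable-stable em λ q≮x →
    ℕ.<-irrefl ⌊x⌋≡1+k (s≤s (proj₂ (⌊⌋-spec x) {k} (q , q≮x , q<1+k)))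

log₂-lower : ∀ {y} 0<y {s} k → lower y s → ℚ.Positive s → 2ℚ ^ k ℚ.≤ s →
  ∀ {q} → q ℚ.< ℕ⇒ℚ k → lower (log₂ y 0<y) q
-- The fraction is `(k - 0) / 1`, its denominator stored as 0; the condition reads 2ᵏ ≤ s¹ · 2⁰.
log₂-lower 0<y {s} k s<y s>0 2ᵏ≤s q<k = s , s<y , s>0 , 0 , k , 0 ,
  ℚ.≤-trans 2ᵏ≤s (ℚ.≤-reflexive (sym (trans (ℚ.*-identityʳ _) (ℚ.*-identityʳ s)))) , q<k

-- From far sequences to rejected pairs.

rejected : Classical → ∀ {n} → Pred (Sequence n) a → Sequence n → Fin n × Fin n → Bool
rejected em 𝒫 f (x , y) = does (em {P = Unrepairable 𝒫 f (｛ x ｝ ∪ ｛ y ｝)})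

congruent-shift : ∀ {n} d (x y : Fin n) → toℕ y ≡ d + toℕ x → Congruent d n x y
congruent-shift {n} d x y y≡d+x = divides (+ 0) (trans
  (cong (λ k → (+ k ℤ.- + toℕ x) ℤ.- + d) y≡d+x) (cancel (+ d) (+ toℕ x) (+ n)))
  where
  cancel : ∀ d x n → (d ℤ.+ x ℤ.- x) ℤ.- d ≡ + 0 ℤ.* n
  cancel = ℤSolver.solve-∀

module Soundness (em : Classical) {a : Level} {n : ℕ} .{{_ : ℕ.NonZero n}} {𝒫 : Pred (Sequence n) a}
  (local : IsLocal 𝒫) (f : Sequence n) (L : ℕ) .{{_ : ℕ.NonZero L}} where

  open Repair em local f using (v; N) public
  open Sampling L n using (hits)

  -- Each unlinked pair `(u, 2 ^ j + u)` belongs to `D (2 ^ j) n` and is rejected; rejected pairs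
  -- that wrap around modulo `n` only enlarge the right side.
  v≤hits : ∀ j → Σ< n (v j) ℕ.≤ hits (rejected em 𝒫 f) j
  v≤hits j = ℕ.≤-trans (sum-mono at)
    (ℕ.≤-reflexive (sym (lsum-D (2 ℕ.^ j) n (bit ∘ rejected em 𝒫 f))))
    where
    term : Fin n → Fin n → ℕ
    term x y = 𝟙 (congruent? (2 ℕ.^ j) n x y) * bit (rejected em 𝒫 f (x , y))

    at : ∀ x → v j (toℕ x) ℕ.≤ sum (term x)
    at x = 𝟙-≤ em λ (x′ , y , x′≡x , y≡ , r) → at-pair x′ y (Fin.toℕ-injective x′≡x) y≡ r
      where
      at-pair : ∀ x′ y → x′ ≡ x → toℕ y ≡ 2 ℕ.^ j + toℕ x → Unrepairable 𝒫 f (｛ x′ ｝ ∪ ｛ y ｝) →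
        1 ℕ.≤ sum (term x)
      at-pair x y refl y≡ r = ℕ.≤-trans
        (ℕ.≤-reflexive (sym (cong₂ _*_
          (𝟙-yes (congruent? (2 ℕ.^ j) n x y) (congruent-shift (2 ℕ.^ j) x y y≡))
          (𝟙-yes em r))))
        (term≤sum (term x) y)

  N≤hits : N L ℕ.≤ Σ< L (hits (rejected em 𝒫 f))
  N≤hits = Σ<-mono L (λ j _ → v≤hits j)

module _ (em : Classical) {a : Level} {ε : ℝ} (ε<1 : ε < fromℕ 1) {n : ℕ}
  {𝒫 : Pred (Sequence n) a} (local : IsLocal 𝒫) (f : Sequence n) (far : Far em ε 𝒫 f)
  where

  private module S = Repair em local f

  -- If `4 * N` reaches `2 ^ suc ℓ`, the hypothesis on `n · ε` suffices. If not, `repair-or-few`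
  -- applies: its first case uses `ε < 1`, its second uses farness from the repaired sequence.
  far⇒n·ε≤16N : ∀ ℓ → 2 ℕ.≤ n → n · ε ≤ fromℕ (4 * 2 ℕ.^ suc ℓ) →
    n · ε ≤ fromℕ (16 * S.N (suc ℓ))
  far⇒n·ε≤16N ℓ 2≤n nε≤4S = go (4 * N ℕ.<? 2 ℕ.^ suc ℓ)
    where
    N : ℕ
    N = S.N (suc ℓ)

    bound : ∀ {k} → k ℕ.≤ 16 * N → n · ε ≤ fromℕ k → n · ε ≤ fromℕ (16 * N)
    bound {k} k≤16N nε≤k = ≤-trans {n · ε} {fromℕ k} {fromℕ (16 * N)} nε≤k (fromℕ-mono k≤16N)

    4N≤16N : 4 * N ℕ.≤ 16 * N
    4N≤16N = ℕ.*-monoˡ-≤ N (ℕ.m≤m+n 4 12)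

    go : Dec (4 * N ℕ.< 2 ℕ.^ suc ℓ) → n · ε ≤ fromℕ (16 * N)
    go (no 4N≮S) = bound
      (ℕ.≤-trans (ℕ.*-monoʳ-≤ 4 (ℕ.≮⇒≥ 4N≮S)) (ℕ.≤-reflexive (sym (ℕ.*-assoc 4 4 N)))) nε≤4S
    go (yes 4N<S) = finish (S.repair-or-few 2≤n ℓ 4N<S)
      where
      finish : n ℕ.≤ 4 * N ⊎ ∃[ g ] 𝒫 g × hamming em f g ℕ.≤ 4 * N → n · ε ≤ fromℕ (16 * N)
      finish (inj₁ n≤4N)              = bound (ℕ.≤-trans n≤4N 4N≤16N) (n·ε≤n n {ε} ε<1)
      finish (inj₂ (g , g∈𝒫 , h≤4N)) = bound (ℕ.≤-trans h≤4N 4N≤16N) (far g g∈𝒫)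

any-≡false : (r : A → Bool) → (∀ x → r x ≡ false) → ∀ xs → Bool.any r xs ≡ false
any-≡false r r≡false []       = refl
any-≡false r r≡false (x ∷ xs) = cong₂ _∨_ (r≡false x) (any-≡false r r≡false xs)

-- The number of scales against the number of iterations.

ρ : ℕ → ℚ
ρ m = ℕ⇒ℚ m ℚ.* (+ 49 ℚ./ 100)

ρ*100 : ∀ m → ρ m ℚ.* ℕ⇒ℚ 100 ≡ ℕ⇒ℚ (m * 49)
ρ*100 m = trans (ℚ.*-assoc (ℕ⇒ℚ m) (+ 49 ℚ./ 100) (ℕ⇒ℚ 100)) (sym (ℕ⇒ℚ-* m 49))

ρ<ℕ : ∀ m k → m * 49 ℕ.< k * 100 → ρ m ℚ.< ℕ⇒ℚ k
ρ<ℕ m k lt = ℚ.*-cancelʳ-<-nonNeg (ℕ⇒ℚ 100)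
  (subst₂ ℚ._<_ (sym (ρ*100 m)) (ℕ⇒ℚ-* k 100) (ℕ⇒ℚ-mono-< lt))

module _ {ε : ℝ} {n : ℕ} (0<4′ : fromℕ 0 < fromℕ 4)
  (0<z : fromℕ 0 < quotient (n · ε) (fromℕ 4) 0<4′) where

  private
    z : ℝ
    z = quotient (n · ε) (fromℕ 4) 0<4′

  log₂-quotient-lower : ∀ k {s} → lower (n · ε) s → ℕ⇒ℚ (4 * 2 ℕ.^ k) ℚ.< s →
    ∀ {q} → q ℚ.< ℕ⇒ℚ k → lower (log₂ z 0<z) q
  -- `2ℚ ^ k` lies below the quotient by the fraction with numerator `s` and denominator 4.
  log₂-quotient-lower k {s} s<nε S<s = log₂-lower {z} 0<z {2ℚ ^ k} k
    (s , ℕ⇒ℚ 4 , s<nε , ℚ.<-irrefl refl , ℚ.≤-<-trans (ℚ.≤-reflexive scale) S<s)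
    (ℚ.positive (ℚ.<-≤-trans (ℚ.positive⁻¹ 1ℚ) (1≤2^ k))) ℚ.≤-refl
    where
    scale : 2ℚ ^ k ℚ.* ℕ⇒ℚ 4 ≡ ℕ⇒ℚ (4 * 2 ℕ.^ k)
    scale = trans (ℚ.*-comm (2ℚ ^ k) (ℕ⇒ℚ 4))
      (trans (cong (ℕ⇒ℚ 4 ℚ.*_) (sym (ℕ⇒ℚ-2^ k))) (sym (ℕ⇒ℚ-* 4 (2 ℕ.^ k))))

  -- A positive `s` below the quotient satisfies `s ≤ s * b < a` because `b ≥ 4`, so it lies below
  -- `n · ε` too and the same exponents serve.
  log₂-quotient-≤ : ∀ 0<y → log₂ z 0<z ≤ log₂ (n · ε) 0<y
  log₂-quotient-≤ 0<y q (s , (a , b , a<nε , b≮4 , sb<a) , s>0 , rest) =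
    s , closed (n · ε) s<a a<nε , s>0 , rest
    where
    instance
      s≥0 : ℚ.NonNegative s
      s≥0 = ℚ.pos⇒nonNeg s {{s>0}}

    s<a : s ℚ.< a
    s<a = ℚ.≤-<-trans (ℚ.≤-trans (ℚ.≤-reflexive (sym (ℚ.*-identityʳ s)))
      (ℚ.*-monoˡ-≤-nonNeg s (ℚ.≤-trans (ℕ⇒ℚ-mono-≤ {1} {4} (s≤s z≤n)) (ℚ.≮⇒≥ b≮4)))) sb<a

-- Were some `q ≥ 4 * 2 ^ suc ℓ` below `n · ε`, then `below` would put all rationals under `suc ℓ`
-- below `x`, contradicting the floor. Roundedness first enlarges `q`, as `below` asks for a strict
-- inequality.
n·ε≤4*2^⌊⌋ : (em : Classical) {ε : ℝ} {n : ℕ} (x : ℝ) (ℓ : ℕ) → ⌊ x ⌋ em ≡ ℓ →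
  (∀ k {s} → lower (n · ε) s → ℕ⇒ℚ (4 * 2 ℕ.^ k) ℚ.< s → ∀ {q} → q ℚ.< ℕ⇒ℚ k → lower x q) →
  n · ε ≤ fromℕ (4 * 2 ℕ.^ suc ℓ)
n·ε≤4*2^⌊⌋ em {ε} {n} x ℓ ⌊x⌋≡ℓ below q q<nε = ℚ.≰⇒> λ S≤q →
  let a , q<a , a<nε = rounded (n · ε) q<nε
      r , r≮x , r<1+ℓ = <-⌊⌋ em x ⌊x⌋≡ℓ
  in r≮x (below (suc ℓ) a<nε (ℚ.≤-<-trans S≤q q<a) r<1+ℓ)

-- The factor 49/100 in ρ works for every ℓ, since 0.49 (ℓ + 1) < max ℓ 1, and
-- suffices for iterations-bound, since 200 · 0.49 > 16 · 6.

ρ<log : (em : Classical) {ε : ℝ} {n : ℕ} → fromℕ 4 ≤ n · ε →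
  (x : ℝ) (ℓ : ℕ) → ⌊ x ⌋ em ≡ ℓ → ∀ 0<y → x ≤ log₂ (n · ε) 0<y →
  lower (log₂ (n · ε) 0<y) (ρ (suc ℓ))
-- A zero floor says nothing from below; here `2 < 4 ≤ n · ε` puts every rational under 1 below the
-- logarithm.
ρ<log em {ε} {n} 4≤nε x zero    _      0<y _     = log₂-lower {n · ε} 0<y {2ℚ} 1
  (4≤nε 2ℚ (ℕ⇒ℚ-mono-< {2} {4} (s≤s (s≤s (s≤s z≤n))))) _ ℚ.≤-refl
  (ρ<ℕ 1 1 (ℕ.m≤m+n 50 50))
ρ<log em {ε} {n} 4≤nε x (suc k) ⌊x⌋≡ℓ 0<y x≤log = x≤log (ρ (suc (suc k)))
  (below-⌊⌋ em x {k} ⌊x⌋≡ℓ (ρ<ℕ (suc (suc k)) (suc k)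
    (ℕ.+-mono-<-≤ (ℕ.m≤m+n 99 1) (ℕ.*-monoʳ-≤ k (ℕ.m≤m+n 49 51)))))

-- Put `b = 16 * N / n`, which is at least `ε`. If `t * N < 6 * (L * n)`, then
-- `t * b < 96 * L < 98 * L`, and `98 * L` is 200 times `ρ L`, so `t` lies strictly below the
-- quotient of which it is the ceiling.
iterations-bound : (em : Classical) (ε : ℝ) (0<ε : fromℕ 0 < ε) (n : ℕ) .{{_ : ℕ.NonZero n}}
  (0<y : fromℕ 0 < n · ε) (L : ℕ) .{{_ : ℕ.NonZero L}} (t : ℕ) →
  ⌈ quotient (200 · log₂ (n · ε) 0<y) ε 0<ε ⌉ em ≡ t → lower (log₂ (n · ε) 0<y) (ρ L) →
  ∀ N → n · ε ≤ fromℕ (16 * N) → 6 * (L * n) ℕ.≤ t * N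
iterations-bound em ε 0<ε n 0<y L t ⌈⌉≡t ρ<log N nε≤16N = ℕ.≮⇒≥ λ tN<6Ln → ℚ.<-irrefl refl
  (≤-⌈⌉ em (quotient (200 · log₂ (n · ε) 0<y) ε 0<ε) ⌈⌉≡t (ℕ⇒ℚ t)
    (ℕ⇒ℚ (96 * L) , b , (ρ L , ρ<log , 96L<200ρ) , b≮ε , tb<96L tN<6Ln))
  where
  instance
    n>0 : ℚ.Positive (ℕ⇒ℚ n)
    n>0 = ℕ⇒ℚ-pos n

    n≥0 : ℚ.NonNegative (ℕ⇒ℚ n)
    n≥0 = ℕ⇒ℚ-nonNeg n

    ℚn≢0 : ℚ.NonZero (ℕ⇒ℚ n)
    ℚn≢0 = ℚ.pos⇒nonZero (ℕ⇒ℚ n)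

  b : ℚ
  b = ℕ⇒ℚ (16 * N) ℚ.* ℚ.1/ (ℕ⇒ℚ n)

  bn≡16N : b ℚ.* ℕ⇒ℚ n ≡ ℕ⇒ℚ (16 * N)
  bn≡16N = *1/-cancel (ℕ⇒ℚ (16 * N)) (ℕ⇒ℚ n)

  b≮ε : ¬ lower ε b
  b≮ε b<ε =
    let b′ , b<b′ , b′<ε = rounded ε b<ε in
    ℚ.<-irrefl (trans (ℚ.*-comm (ℕ⇒ℚ n) b) bn≡16N)
      (nε≤16N (ℕ⇒ℚ n ℚ.* b) (b′ , b′<ε , ℚ.*-monoʳ-<-pos (ℕ⇒ℚ n) b<b′))

  96L<200ρ : ℕ⇒ℚ (96 * L) ℚ.< ℕ⇒ℚ 200 ℚ.* ρ L
  96L<200ρ = subst (ℕ⇒ℚ (96 * L) ℚ.<_)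
    (begin
      ℕ⇒ℚ (2 * (L * 49))               ≡⟨ ℕ⇒ℚ-* 2 (L * 49) ⟩
      2ℚ ℚ.* ℕ⇒ℚ (L * 49)              ≡⟨ cong (2ℚ ℚ.*_) (ρ*100 L) ⟨
      2ℚ ℚ.* (ρ L ℚ.* ℕ⇒ℚ 100)         ≡⟨ cong (2ℚ ℚ.*_) (ℚ.*-comm (ρ L) (ℕ⇒ℚ 100)) ⟩
      2ℚ ℚ.* (ℕ⇒ℚ 100 ℚ.* ρ L)         ≡⟨ ℚ.*-assoc 2ℚ (ℕ⇒ℚ 100) (ρ L) ⟨
      ℕ⇒ℚ 200 ℚ.* ρ L                  ∎)
    (ℕ⇒ℚ-mono-< (ℕ.<-≤-trans (ℕ.*-monoˡ-< L (ℕ.m≤m+n 97 1)) (ℕ.≤-reflexive (98L L))))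
    where
    open ≡-Reasoning

    98L : ∀ L → 98 * L ≡ 2 * (L * 49)
    98L = solve-∀

  tb<96L : t * N ℕ.< 6 * (L * n) → ℕ⇒ℚ t ℚ.* b ℚ.< ℕ⇒ℚ (96 * L)
  tb<96L tN<6Ln = ℚ.*-cancelʳ-<-nonNeg (ℕ⇒ℚ n) (begin-strict
    ℕ⇒ℚ t ℚ.* b ℚ.* ℕ⇒ℚ n        ≡⟨ ℚ.*-assoc (ℕ⇒ℚ t) b (ℕ⇒ℚ n) ⟩
    ℕ⇒ℚ t ℚ.* (b ℚ.* ℕ⇒ℚ n)      ≡⟨ cong (ℕ⇒ℚ t ℚ.*_) bn≡16N ⟩
    ℕ⇒ℚ t ℚ.* ℕ⇒ℚ (16 * N)       ≡⟨ ℕ⇒ℚ-* t (16 * N) ⟨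
    ℕ⇒ℚ (t * (16 * N))           <⟨ ℕ⇒ℚ-mono-< scaled ⟩
    ℕ⇒ℚ (96 * L * n)             ≡⟨ ℕ⇒ℚ-* (96 * L) n ⟩
    ℕ⇒ℚ (96 * L) ℚ.* ℕ⇒ℚ n       ∎)
    where
    open ℚ.≤-Reasoning

    left : ∀ t N → t * (16 * N) ≡ 16 * (t * N)
    left = solve-∀

    right : ∀ L n → 16 * (6 * (L * n)) ≡ 96 * L * n
    right = solve-∀

    scaled : t * (16 * N) ℕ.< 96 * L * n
    scaled = subst₂ ℕ._<_ (sym (left t N)) (right L n) (ℕ.*-monoʳ-< 16 tN<6Ln)

-- Assembly of soundness, completeness and nonadaptivity.

-- The scale, the iteration count and the distribution are variables here, so that only the
-- inequalities between them matter and not their definitions through logarithms.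
soundness-bound : (em : Classical) {ε : ℝ} {n : ℕ} .{{_ : ℕ.NonZero n}} (ℓ t : ℕ) →
  ∀ μ → μ ≡ Sampling.sample (suc ℓ) n →
  n · ε ≤ fromℕ (4 * 2 ℕ.^ suc ℓ) →
  (∀ N → n · ε ≤ fromℕ (16 * N) → 6 * (suc ℓ * n) ℕ.≤ t * N) →
  ε < fromℕ 1 → 2 ℕ.≤ n → {𝒫 : Pred (Sequence n) a} → IsLocal 𝒫 →
  ∀ f → Far em ε 𝒫 f →
  1ℚ ℚ.- (+ 1 / 7) ℚ.≤ Pr (independent t μ) (λ c → Bool.any (rejected em 𝒫 f) (Vec.toList c))
soundness-bound em {ε} {n} ℓ t _ refl nε≤ t≥ ε<1 2≤n {𝒫} local f far =
  Sampling.sample-amplify (suc ℓ) n (rejected em 𝒫 f) t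
    (ℕ.≤-trans (t≥ (Soundness.N em local f (suc ℓ) (suc ℓ))
        (far⇒n·ε≤16N em {ε = ε} ε<1 local f far ℓ 2≤n nε≤))
      (ℕ.*-monoʳ-≤ t (Soundness.N≤hits em local f (suc ℓ))))

Unrepairable-resp : ∀ {n} {𝒫 : Pred (Sequence n) a} {f g} {S : Pred (Fin n) 0ℓ} →
  (∀ i → S i → f i ≈ g i) → Unrepairable 𝒫 f S → Unrepairable 𝒫 g S
Unrepairable-resp {f = f} {g} f≈g ¬r (h , h≈g , h∈𝒫) = ¬r
  (h , (λ i i∈S → ≈-trans {h i} {g i} {f i} (h≈g i i∈S) (≈-sym {f i} {g i} (f≈g i i∈S))) , h∈𝒫)

lemma6p2 : (em : Classical) {a : Level} (ε : ℝ) (0<ε : fromℕ 0 < ε) → ε < fromℕ 1 →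
    (n : ℕ) (4≤nε : fromℕ 4 ≤ n · ε) →
    (𝒫 : Pred (Sequence n) a) → IsLocal 𝒫 →
    IsNonadaptiveOneSidedTester em 𝒫 ε (+ 1 / 7) (pairTester em ε 0<ε n 4≤nε 𝒫)
lemma6p2 em ε 0<ε ε<1 n 4≤nε 𝒫 local = record
  { nonadaptive  = λ c f g → same f g (Vec.toList c)
  -- A member of the property is its own repair on every pair.
  ; completeness = λ f f∈𝒫 {c} _ → any-≡false _ (λ (x , y) →
      dec-false em λ ¬r → ¬r (f , (λ _ _ → (λ _ q<fi → q<fi) , (λ _ q<fi → q<fi)) , f∈𝒫)) (Vec.toList c)
  ; soundness    = λ f far → soundness-bound em {ε = ε} ℓ₀ t₀ μ₀ refl n·ε≤ t₀≥ ε<1 (ℕ.<⇒≤ 2<n) local f far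
  }
  where
  2<n : 2 ℕ.< n
  2<n = 4≤n·ε⇒2<n {n} {ε} ε<1 4≤nε

  instance
    n≢0 : ℕ.NonZero n
    n≢0 = ℕ.>-nonZero (ℕ.≤-trans (s≤s z≤n) 2<n)

  -- The verdict is computed from all of `f`, but repairability on a pair depends only on the two
  -- queried values up to `≈`.
  same : ∀ f g ps → (∀ {x} → x ∈ List.concatMap (λ (x , y) → x ∷ y ∷ []) ps → f x ≈ g x) →
    Bool.any (rejected em 𝒫 f) ps ≡ Bool.any (rejected em 𝒫 g) ps
  same f g []             f≈g = refl
  same f g ((x , y) ∷ ps) f≈g = cong₂ _∨_
    (does-⇔ (mk⇔
      (Unrepairable-resp {f = f} {g = g} agree)
      (Unrepairable-resp {f = g} {g = f} (λ i i∈ → ≈-sym {f i} {g i} (agree i i∈)))) em em)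
    (same f g ps (λ x∈ → f≈g (there (there x∈))))
    where
    agree : ∀ i → (｛ x ｝ ∪ ｛ y ｝) i → f i ≈ g i
    agree i (inj₁ refl) = f≈g (here refl)
    agree i (inj₂ refl) = f≈g (there (here refl))

  ℓ₀ t₀ : ℕ
  ℓ₀ = maxScale em ε 0<ε n 4≤nε
  t₀ = iterations em ε 0<ε n 4≤nε

  μ₀ : Dist (Fin n × Fin n)
  μ₀ = samplePair em ε 0<ε n 4≤nε

  x₀ : ℝ
  x₀ = log₂ (quotient (n · ε) (fromℕ 4) (0<4 em ε 0<ε n 4≤nε)) (0<nε/4 em ε 0<ε n 4≤nε)

  n·ε≤ : n · ε ≤ fromℕ (4 * 2 ℕ.^ suc ℓ₀)
  n·ε≤ = n·ε≤4*2^⌊⌋ em {ε} {n} x₀ ℓ₀ refl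
    (log₂-quotient-lower {ε} {n} (0<4 em ε 0<ε n 4≤nε) (0<nε/4 em ε 0<ε n 4≤nε))

  x₀≤log : ∀ 0<y → x₀ ≤ log₂ (n · ε) 0<y
  x₀≤log = log₂-quotient-≤ {ε} {n} (0<4 em ε 0<ε n 4≤nε) (0<nε/4 em ε 0<ε n 4≤nε)

  t₀≥ : ∀ N → n · ε ≤ fromℕ (16 * N) → 6 * (suc ℓ₀ * n) ℕ.≤ t₀ * N
  t₀≥ = iterations-bound em ε 0<ε n (0<nε em ε 0<ε n 4≤nε) (suc ℓ₀) t₀ refl
    (ρ<log em {ε} {n} 4≤nε x₀ ℓ₀ refl (0<nε em ε 0<ε n 4≤nε) (x₀≤log (0<nε em ε 0<ε n 4≤nε)))
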